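{- For every real $L>0$ there is a finite poset $P$ of width two such that $$\operatorname{gap}_P(C)\ge L$$ for every nonempty chain $C\subseteq P$.
   Context: The width of a poset is the largest size of a pairwise incomparable subset. A linear extension of a finite poset $P$ is an order-preserving bijection $f:P\to\{1,\dots,|P|\}$, and $h_P(x)=\mathbb E[f(x)]$ for $f$ a uniformly random linear extension of $P$. For a nonempty chain $C=\{y_1<\cdots<y_m\}$ in $P$, the chain gap $\operatorname{gap}_P(C)$ is the largest difference between consecutive terms in the increasing list $0,\ h_P(y_1),\ldots,h_P(y_m),\ |P|+1$. -}

module Defs where

open import Data.Fin.Base as Fin using (Fin; toℕ; fromℕ<; combine; punchOut; finToFun; funToFin)
import Data.Fin.Properties as Finₚ
open import Data.Fin.Subset using (Subset; _∈_; _∉_; _⊂_; ∣_∣)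
open import Data.Fin.Subset.Properties using (∣p∣≤n; ∣⊤∣≡n; ⊆⊤; ∈⊤; p⊂q⇒∣p∣<∣q∣)
open import Data.Integer.Base using (+_)
open import Data.List.Base using (List; []; _∷_; length; map; filter; allFin)
open import Data.List.Membership.Propositional using () renaming (_∈_ to _∈ˡ_)
open import Data.List.Membership.Propositional.Properties using (∈-map⁺; ∈-filter⁺; ∈-allFin)
open import Data.List.NonEmpty.Base using (List⁺; toList)
open import Data.List.Relation.Unary.Any using (here; there)
open import Data.List.Relation.Unary.Linked using (Linked)
open import Data.Nat.Base as ℕ using (ℕ; suc; NonZero)
import Data.Nat.Properties as ℕₚ
open import Data.Nat.ListAction using (sum)
open import Data.Product.Base using (∃; _×_; _,_; proj₁; proj₂)
open import Data.Rational.Base as ℚ using (ℚ; 0ℚ; _/_)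
import Data.Rational.Properties as ℚₚ
open import Data.Vec.Base using (tabulate)
open import Data.Vec.Properties using (lookup⇒[]=; []=⇒lookup; lookup∘tabulate)
open import Function.Base using (_∘_)
open import Function.Definitions using (Injective; Surjective; Bijective)
open import Level using (0ℓ)
open import Relation.Binary.Core using (Rel)
open import Relation.Binary.Definitions using (Monotonic₁; tri<; tri≈; tri>)
import Relation.Binary.Construct.NonStrictToStrict as ToStrict
open import Relation.Binary.PropositionalEquality using (_≡_; _≢_; refl; sym; trans; cong; subst; subst₂)
open import Relation.Binary.Structures using (IsDecPartialOrder)
open import Relation.Nullary.Decidable using (Dec; yes; no; does; map′; _×-dec_; _→-dec_; dec-true)
open import Relation.Nullary.Negation.Core using (¬_; contradiction)
open import Relation.Unary using (Pred; Decidable)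

------------------------------------------------------------------------
-- Real numbers, after Bishop: regular sequences of rationals. The term
-- of index n is within 1/(n+1) of the real number represented.

record ℝ : Set where
  field
    seq     : ℕ → ℚ
    regular : ∀ m n → ℚ.∣ seq m ℚ.- seq n ∣ ℚ.≤ (+ 1 / suc m) ℚ.+ (+ 1 / suc n)

open ℝ public using (seq)

infix 4 _<ℝ_ _≤ℝ_ _≥ℝ_

_<ℝ_ : Rel ℝ 0ℓ
x <ℝ y = ∃ λ n → seq x n ℚ.+ (+ 2 / suc n) ℚ.< seq y n

_≤ℝ_ : Rel ℝ 0ℓ
x ≤ℝ y = ∀ n → seq x n ℚ.≤ seq y n ℚ.+ (+ 2 / suc n)

_≥ℝ_ : Rel ℝ 0ℓ
x ≥ℝ y = y ≤ℝ x

fromℚ : ℚ → ℝ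
fromℚ q = record
  { seq     = λ _ → q
  ; regular = λ m n → subst (ℚ._≤ (+ 1 / suc m) ℚ.+ (+ 1 / suc n))
      (sym (cong ℚ.∣_∣ (ℚₚ.+-inverseʳ q)))
      (ℚₚ.+-mono-≤ (0≤1/ m) (0≤1/ n))
  }
  where
  0≤1/ : ∀ k → 0ℚ ℚ.≤ + 1 / suc k
  0≤1/ k = ℚₚ.nonNegative⁻¹ (+ 1 / suc k) {{ℚₚ.normalize-nonNeg 1 (suc k)}}

0ℝ : ℝ
0ℝ = fromℚ 0ℚ

------------------------------------------------------------------------
-- Finite posets, up to isomorphism: the underlying set is Fin size.

record FinitePoset : Set₁ where
  infix 4 _≤_
  field
    size              : ℕ
    _≤_               : Rel (Fin size) 0ℓ
    isDecPartialOrder : IsDecPartialOrder _≡_ _≤_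

  open IsDecPartialOrder isDecPartialOrder public
    using (_≤?_) renaming (refl to ≤-refl; trans to ≤-trans; antisym to ≤-antisym)

  open ToStrict _≡_ _≤_ public using (_<_)

module _ (P : FinitePoset) where
  open FinitePoset P

  IsAntichain : Subset size → Set
  IsAntichain A = ∀ {x y} → x ∈ A → y ∈ A → x ≢ y → ¬ (x ≤ y) × ¬ (y ≤ x)

  HasWidth : ℕ → Set
  HasWidth w = (∃ λ A → IsAntichain A × ∣ A ∣ ≡ w) × (∀ A → IsAntichain A → ∣ A ∣ ℕ.≤ w)

  -- A nonempty chain {y₁ < ⋯ < yₘ}, presented by its increasing enumeration.
  record NonemptyChain : Set where
    field
      elements   : List⁺ (Fin size)
      increasing : Linked _<_ (toList elements)

  -- The values of a linear extension are numbered from 0 here; `h` shifts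
  -- them to {1,…,|P|}.
  IsLinearExtension : (Fin size → Fin size) → Set
  IsLinearExtension f = Bijective _≡_ _≡_ f × Monotonic₁ _≤_ Fin._≤_ f

  isLinearExtension? : Decidable IsLinearExtension
  isLinearExtension? f = (injective? ×-dec surjective?) ×-dec monotone?
    where
    injective? : Dec (Injective _≡_ _≡_ f)
    injective? = map′ (λ p {x} {y} → p x y) (λ p x y → p {x} {y})
      (Finₚ.all? λ x → Finₚ.all? λ y → (f x Finₚ.≟ f y) →-dec (x Finₚ.≟ y))

    surjective? : Dec (Surjective _≡_ _≡_ f)
    surjective? = map′
      (λ p y → proj₁ (p y) , λ { refl → proj₂ (p y) })
      (λ p y → proj₁ (p y) , proj₂ (p y) refl)
      (Finₚ.all? λ y → Finₚ.any? λ x → f x Finₚ.≟ y)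

    monotone? : Dec (Monotonic₁ _≤_ Fin._≤_ f)
    monotone? = map′ (λ p {x} {y} → p x y) (λ p x y → p {x} {y})
      (Finₚ.all? λ x → Finₚ.all? λ y → (x ≤? y) →-dec (f x Finₚ.≤? f y))

  -- `finToFun` runs through every function Fin size → Fin size exactly once.
  linearExtensions : List (Fin size → Fin size)
  linearExtensions = filter isLinearExtension? (map finToFun (allFin (size ℕ.^ size)))

------------------------------------------------------------------------
-- Every finite poset has a linear extension: rank the elements by the
-- size of their principal down-set, ties broken by index.

private
  module _ {n : ℕ} {Q : Pred (Fin n) 0ℓ} (Q? : Decidable Q) where

    ⟦_⟧ : Subset n
    ⟦_⟧ = tabulate (does ∘ Q?)

    ∈⟦⟧⁺ : ∀ {x} → Q x → x ∈ ⟦_⟧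
    ∈⟦⟧⁺ {x} q = lookup⇒[]= x ⟦_⟧ (trans (lookup∘tabulate (does ∘ Q?) x) (dec-true (Q? x) q))

    ∈⟦⟧⁻ : ∀ {x} → x ∈ ⟦_⟧ → Q x
    ∈⟦⟧⁻ {x} x∈ with Q? x | trans (sym (lookup∘tabulate (does ∘ Q?) x)) ([]=⇒lookup x∈)
    ... | yes q | _ = q
    ... | no  _ | ()

  injective⇒surjective : ∀ {n} {f : Fin n → Fin n} → Injective _≡_ _≡_ f → Surjective _≡_ _≡_ f
  injective⇒surjective {suc n} {f} inj y with Finₚ.any? (λ x → f x Finₚ.≟ y)
  ... | yes (x , fx≡y) = x , λ { refl → fx≡y }
  ... | no  missed     = contradiction (Finₚ.injective⇒≤ g-inj) ℕₚ.1+n≰n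
    where
    y≢f : ∀ x → y ≢ f x
    y≢f x y≡fx = missed (x , sym y≡fx)
    g-inj : Injective _≡_ _≡_ (λ x → punchOut (y≢f x))
    g-inj {a} {b} eq = inj (Finₚ.punchOut-injective (y≢f a) (y≢f b) eq)

  module _ (P : FinitePoset) where
    open FinitePoset P

    down : Fin size → Subset size
    down x = ⟦ _≤? x ⟧

    height : Fin size → Fin (suc size)
    height x = fromℕ< (ℕ.s≤s (∣p∣≤n (down x)))

    key : Fin size → Fin (suc size ℕ.* size)
    key x = combine (height x) x

    key-mono : ∀ {x y} → x < y → key x Fin.< key y
    key-mono {x} {y} (x≤y , x≢y) = Finₚ.combine-monoˡ-< x y
      (subst₂ ℕ._<_ (sym (Finₚ.toℕ-fromℕ< _)) (sym (Finₚ.toℕ-fromℕ< _)) (p⊂q⇒∣p∣<∣q∣ down⊂))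
      where
      down⊂ : down x ⊂ down y
      down⊂ = (λ z∈ → ∈⟦⟧⁺ (_≤? y) (≤-trans (∈⟦⟧⁻ (_≤? x) z∈) x≤y))
            , y , ∈⟦⟧⁺ (_≤? y) ≤-refl , λ y∈ → x≢y (≤-antisym x≤y (∈⟦⟧⁻ (_≤? x) y∈))

    below? : ∀ x → Decidable (λ y → key y Fin.< key x)
    below? x y = key y Finₚ.<? key x

    below : Fin size → Subset size
    below x = ⟦ below? x ⟧

    x∉below : ∀ x → x ∉ below x
    x∉below x x∈ = ℕₚ.<-irrefl refl (∈⟦⟧⁻ (below? x) x∈)

    rank< : ∀ x → ∣ below x ∣ ℕ.< size
    rank< x = subst (∣ below x ∣ ℕ.<_) (∣⊤∣≡n size)
      (p⊂q⇒∣p∣<∣q∣ (⊆⊤ , x , ∈⊤ , x∉below x))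

    rank : Fin size → Fin size
    rank x = fromℕ< (rank< x)

    rank-mono : ∀ {x y} → key x Fin.< key y → rank x Fin.< rank y
    rank-mono {x} {y} kx<ky =
      subst₂ ℕ._<_ (sym (Finₚ.toℕ-fromℕ< _)) (sym (Finₚ.toℕ-fromℕ< _)) (p⊂q⇒∣p∣<∣q∣ below⊂)
      where
      below⊂ : below x ⊂ below y
      below⊂ = (λ z∈ → ∈⟦⟧⁺ (below? y) (ℕₚ.<-trans (∈⟦⟧⁻ (below? x) z∈) kx<ky))
             , x , ∈⟦⟧⁺ (below? y) kx<ky , x∉below x

    rank-injective : Injective _≡_ _≡_ rank
    rank-injective {x} {y} eq with Finₚ.<-cmp (key x) (key y)
    ... | tri< lt _ _ = contradiction eq (Finₚ.<⇒≢ (rank-mono lt))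
    ... | tri≈ _ e _  = Finₚ.combine-injectiveʳ (height x) x (height y) y e
    ... | tri> _ _ gt = contradiction (sym eq) (Finₚ.<⇒≢ (rank-mono gt))

    rank-≤ : Monotonic₁ _≤_ Fin._≤_ rank
    rank-≤ {x} {y} x≤y with x Finₚ.≟ y
    ... | yes refl = ℕₚ.≤-refl
    ... | no  x≢y  = ℕₚ.<⇒≤ (rank-mono (key-mono (x≤y , x≢y)))

    resp-≗ : ∀ {f g : Fin size → Fin size} → (∀ x → g x ≡ f x) →
             Injective _≡_ _≡_ f → Monotonic₁ _≤_ Fin._≤_ f → IsLinearExtension P g
    resp-≗ {f} {g} g≗f inj mono = (g-inj , injective⇒surjective g-inj) , λ {x} {y} x≤y →
      subst₂ Fin._≤_ (sym (g≗f x)) (sym (g≗f y)) (mono x≤y)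
      where
      g-inj : Injective _≡_ _≡_ g
      g-inj {x} {y} eq = inj (trans (sym (g≗f x)) (trans eq (g≗f y)))

    ∈⇒nonZero : ∀ {A : Set} {x : A} {xs} → x ∈ˡ xs → NonZero (length xs)
    ∈⇒nonZero (here _)  = _
    ∈⇒nonZero (there _) = _

linearExtensions-nonZero : ∀ P → NonZero (length (linearExtensions P))
linearExtensions-nonZero P = ∈⇒nonZero P (∈-filter⁺ (isLinearExtension? P)
  (∈-map⁺ finToFun (∈-allFin (funToFin (rank P))))
  (resp-≗ P (Finₚ.finToFun-funToFin (rank P)) (rank-injective P) (rank-≤ P)))

------------------------------------------------------------------------
-- Average heights and chain gaps

-- largestStep a (b₁ ∷ ⋯ ∷ bₘ ∷ []) c is the largest difference between
-- consecutive terms of a, b₁, …, bₘ, c.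
largestStep : ℚ → List ℚ → ℚ → ℚ
largestStep a []       c = c ℚ.- a
largestStep a (b ∷ bs) c = (b ℚ.- a) ℚ.⊔ largestStep b bs c

module _ (P : FinitePoset) where
  open FinitePoset P

  h : Fin size → ℚ
  h x = _/_ (+ sum (map (λ f → suc (toℕ (f x))) (linearExtensions P)))
            (length (linearExtensions P)) {{linearExtensions-nonZero P}}

  gap : NonemptyChain P → ℚ
  gap C = largestStep 0ℚ (map h (toList (NonemptyChain.elements C))) (+ suc size / 1)

{-# OPTIONS --safe #-}
module Submission where

open import Defs
open import Data.Product using (Σ-syntax; _×_)
open import Algebra.Properties.CommutativeSemigroup using (interchange)
open import Data.Empty using (⊥)
open import Data.Fin.Base as Fin using (Fin; toℕ; fromℕ<; splitAt; join; _↑ˡ_; _↑ʳ_; finToFun; funToFin; inject≤) renaming (zero to fzero; suc to fsuc)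
import Data.Fin.Properties as Finₚ
open import Data.Fin.Subset using (Subset; ∣_∣; ⁅_⁆; inside; outside; Empty) renaming (_∈_ to _∈ₛ_)
open import Data.Fin.Subset.Properties using (∣⊥∣≡0; ∣⁅x⁆∣≡1; x∈⁅y⁆⇒x≡y; Empty-unique)
open import Data.Integer.Base as ℤ using (-[1+_]) renaming (+_ to pos)
import Data.Integer.Properties as ℤₚ
open import Data.List.Base as List using (List; []; _∷_; length; map; concatMap; applyUpTo; allFin)
open import Data.List.Membership.Propositional using (_∈_; find; lose)
open import Data.List.Membership.Propositional.Properties
open import Data.List.Membership.Propositional.Properties.WithK using (unique∧set⇒bag)
open import Data.List.NonEmpty.Base using (toList)
open import Data.List.Properties using (map-++; map-∘; map-cong; map-cong-local; length-map)
open import Data.List.Relation.Binary.BagAndSetEquality using (∼bag⇒↭)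
open import Data.List.Relation.Binary.Disjoint.Propositional using (Disjoint)
open import Data.List.Relation.Binary.Permutation.Propositional using (_↭_)
open import Data.List.Relation.Binary.Permutation.Propositional.Properties using (↭-length) renaming (map⁺ to ↭-map⁺)
open import Data.List.Relation.Unary.All as All using (All; []; _∷_)
open import Data.List.Relation.Unary.All.Properties using (all-filter) renaming (map⁺ to All-map⁺)
open import Data.List.Relation.Unary.AllPairs as AllPairs using (AllPairs; []; _∷_)
import Data.List.Relation.Unary.AllPairs.Properties as AllPairsₚ
open import Data.List.Relation.Unary.Any using (here; there)
open import Data.List.Relation.Unary.Linked as Linked using (Linked; []; _∷_)
import Data.List.Relation.Unary.Linked.Properties as Linkedₚ
open import Data.List.Relation.Unary.Unique.Propositional using (Unique)
import Data.List.Relation.Unary.Unique.Propositional.Properties as Unique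
open import Data.Nat using (ℕ; zero; suc; _+_; _*_; _∸_; _^_; _≤_; _<_; _≤?_; _<?_; _⊓_; z≤n; s≤s; s≤s⁻¹; z<s; s<s; NonZero; >-nonZero⁻¹; ≢-nonZero)
open import Data.Nat.DivMod
open import Data.Nat.Divisibility using (n∣m*n)
open import Data.Nat.ListAction using (sum)
open import Data.Nat.ListAction.Properties using (sum-++; sum-↭)
open import Data.Nat.Properties
open import Data.Nat.Tactic.RingSolver using (solve-∀)
open import Data.Product.Base using (_,_; ∃; proj₁; proj₂)
open import Data.Rational.Base as ℚ using (ℚ; mkℚ; 0ℚ)
import Data.Rational.Properties as ℚₚ
open import Data.Rational.Unnormalised.Base as ℚᵘ using (mkℚᵘ; *≤*; *≡*)
import Data.Rational.Unnormalised.Properties as ℚᵘₚ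
open import Data.Sum.Base using (_⊎_; inj₁; inj₂)
open import Data.Sum.Properties using (inj₁-injective; inj₂-injective)
open import Data.Vec.Base as Vec using (Vec; []; _∷_; _++_; lookup; tabulate; here; there)
open import Data.Vec.Properties using (∷-injectiveˡ; ∷-injectiveʳ; []=⇒lookup; lookup⇒[]=; lookup-splitAt; lookup-++ˡ; lookup-++ʳ; lookup∘tabulate; tabulate∘lookup; tabulate-cong)
open import Function.Base using (_∘_; it)
open import Function.Bundles using (mk⇔)
open import Function.Definitions using (Injective; Surjective)
open import Level using (0ℓ)
open import Relation.Binary.Core using (Rel)
open import Relation.Binary.Definitions using (tri<; tri≈; tri>)
open import Relation.Binary.PropositionalEquality
open import Relation.Nullary using (¬_; Dec; yes; no; contradiction)

-- The poset consists of two chains a_0 < a_1 < ⋯ and b_0 < b_1 < ⋯ with a_k < b_l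
-- exactly when ρ(k) ≤ l. A linear extension is a nondecreasing sequence x_k ≤ ρ(k),
-- x_k being the number of b's before a_k: a lattice path below the boundary ρ. The a's
-- come in blocks of p on which ρ is constant, and ρ rises by q₀ + i across block i, so
-- the boundary is convex and bends very slowly at each corner.
--
-- At the end of a block the deficit d = ρ(k) − x_k has weights w_d with
-- (q − d) w_d ≤ (q + d + 2) w_{d+1}, q = q₀ + i: counting the paths before and after the
-- corner by iterated sums, the ratio w_{d+1} / w_d is smallest when the path touches the
-- two neighbouring corners. Hence E[d] is at least of order √q₀, and a chain that
-- switches from the a's to the b's has a large gap at the switch. A chain of b's alone
-- has a large gap in the first block, where b's are rare, and a chain of a's alone has
-- one in the last block, where a's are rare.

-- The demands on the parameters compete. The deficit bound needs the rise to grow by only one per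
-- corner; rare b's in the first block need `p` much larger than `q₀`; rare a's in the last block
-- need a final rise much larger than `p`. They are compatible because the deficit bound depends on
-- neither `p` nor the number `T` of blocks: in the product of the ratios before and after the
-- corner the factors containing `p` cancel, leaving (q - d) / (q + d + 2). So one chooses in turn
-- `q₀` of order g², `p` = (`q₀` + 1)g and `T` = (`p` + 1)g, and the many blocks let the rise climb
-- in unit steps up to order `p` g. The products of (q - d) / (q + d + 2) behave like exp(-d²/q), a
-- profile of width √q, whence the comparison of g² with `q₀`. No b lies below an a, so every chain
-- is a run of a's followed by a run of b's, and the three cases are exhaustive. Estimates stay in
-- ℕ: ratios are cross-multiplied and expectations are multiplied by the number of linear
-- extensions.

-- Finite sums of natural numbers

Σ< : ℕ → (ℕ → ℕ) → ℕ
Σ< zero    f = 0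
Σ< (suc n) f = Σ< n f + f n

Σ<-cong : ∀ n {f g} → (∀ {x} → x < n → f x ≡ g x) → Σ< n f ≡ Σ< n g
Σ<-cong zero    eq = refl
Σ<-cong (suc n) eq = cong₂ _+_ (Σ<-cong n (λ x<n → eq (m<n⇒m<1+n x<n))) (eq ≤-refl)

Σ<-mono : ∀ n {f g} → (∀ {x} → x < n → f x ≤ g x) → Σ< n f ≤ Σ< n g
Σ<-mono zero    le = z≤n
Σ<-mono (suc n) le = +-mono-≤ (Σ<-mono n (λ x<n → le (m<n⇒m<1+n x<n))) (le ≤-refl)

Σ<-+ : ∀ n f g → Σ< n (λ x → f x + g x) ≡ Σ< n f + Σ< n g
Σ<-+ zero    f g = refl
Σ<-+ (suc n) f g rewrite Σ<-+ n f g = interchange +-commutativeSemigroup (Σ< n f) (Σ< n g) (f n) (g n)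

Σ<-*ˡ : ∀ n c f → Σ< n (λ x → c * f x) ≡ c * Σ< n f
Σ<-*ˡ zero    c f = sym (*-zeroʳ c)
Σ<-*ˡ (suc n) c f rewrite Σ<-*ˡ n c f = sym (*-distribˡ-+ c (Σ< n f) (f n))

Σ<-*ʳ : ∀ n c f → Σ< n (λ x → f x * c) ≡ Σ< n f * c
Σ<-*ʳ n c f = trans (Σ<-cong n (λ {x} _ → *-comm (f x) c)) (trans (Σ<-*ˡ n c f) (*-comm c (Σ< n f)))

Σ<-head : ∀ n f → Σ< (suc n) f ≡ f 0 + Σ< n (λ x → f (suc x))
Σ<-head zero    f = sym (+-identityʳ (f 0))
Σ<-head (suc n) f = trans (cong (_+ f (suc n)) (Σ<-head n f)) (+-assoc (f 0) _ _)

Σ<-reverse : ∀ r f → Σ< (suc r) f ≡ Σ< (suc r) (λ d → f (r ∸ d))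
Σ<-reverse zero    f = refl
Σ<-reverse (suc r) f = begin
  Σ< (suc r) f + f (suc r)                       ≡⟨ +-comm _ (f (suc r)) ⟩
  f (suc r) + Σ< (suc r) f                       ≡⟨ cong (f (suc r) +_) (Σ<-reverse r f) ⟩
  f (suc r) + Σ< (suc r) (λ d → f (r ∸ d))       ≡⟨ Σ<-head (suc r) (λ d → f (suc r ∸ d)) ⟨
  Σ< (suc (suc r)) (λ d → f (suc r ∸ d))         ∎
  where open ≡-Reasoning

Σ<-extend : ∀ {m n} f → m ≤ n → (∀ {x} → m ≤ x → f x ≡ 0) → Σ< n f ≡ Σ< m f
Σ<-extend {n = zero}  f z≤n  zeros = refl
Σ<-extend {m} {suc n} f m≤1+n zeros with m≤n⇒m<n∨m≡n m≤1+n
... | inj₂ refl       = refl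
... | inj₁ (s≤s m≤n) rewrite zeros m≤n | Σ<-extend f m≤n zeros = +-identityʳ _

-- The sum over lo ≤ x < hi, hence 0 when hi ≤ lo.
Σ[_,_⟩ : ℕ → ℕ → (ℕ → ℕ) → ℕ
Σ[ lo , hi ⟩ f = Σ< (hi ∸ lo) (λ j → f (lo + j))

module _ (f : ℕ → ℕ) where

  Σ[⟩-empty : ∀ n → Σ[ n , n ⟩ f ≡ 0
  Σ[⟩-empty n rewrite n∸n≡0 n = refl

  Σ[⟩-head : ∀ {lo hi} → lo < hi → Σ[ lo , hi ⟩ f ≡ f lo + Σ[ suc lo , hi ⟩ f
  Σ[⟩-head {lo} {suc hi} (s≤s lo≤hi) rewrite +-∸-assoc 1 lo≤hi = trans
    (Σ<-head (hi ∸ lo) (λ j → f (lo + j)))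
    (cong₂ _+_ (cong f (+-identityʳ lo)) (Σ<-cong (hi ∸ lo) (λ {x} _ → cong f (+-suc lo x))))

  Σ[⟩-last : ∀ {lo hi} → lo ≤ hi → Σ[ lo , suc hi ⟩ f ≡ Σ[ lo , hi ⟩ f + f hi
  Σ[⟩-last {lo} {hi} lo≤hi rewrite +-∸-assoc 1 lo≤hi =
    cong (λ x → Σ[ lo , hi ⟩ f + f x) (m+[n∸m]≡n lo≤hi)

  Σ[⟩-singleton : ∀ n → Σ[ n , suc n ⟩ f ≡ f n
  Σ[⟩-singleton n = trans (Σ[⟩-last ≤-refl) (cong (_+ f n) (Σ[⟩-empty n))

-- Exchange of summation over y ≤ x. It lets a column of a path pass from the part still to come to
-- the part already traversed.
Σ-adjoint : ∀ h F ψ →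
  Σ< h (λ y → F y * Σ[ y , h ⟩ ψ) ≡ Σ< h (λ x → Σ< (suc x) F * ψ x)
Σ-adjoint zero    F ψ = refl
Σ-adjoint (suc h) F ψ = begin
  Σ< h (λ y → F y * Σ[ y , suc h ⟩ ψ) + F h * Σ[ h , suc h ⟩ ψ
    ≡⟨ cong₂ _+_ (Σ<-cong h (λ {y} y<h → trans (cong (F y *_) (Σ[⟩-last ψ (<⇒≤ y<h)))
                                                (*-distribˡ-+ (F y) _ (ψ h))))
                 (cong (F h *_) (Σ[⟩-singleton ψ h)) ⟩
  Σ< h (λ y → F y * Σ[ y , h ⟩ ψ + F y * ψ h) + F h * ψ h
    ≡⟨ cong (_+ F h * ψ h) (Σ<-+ h _ _) ⟩
  Σ< h (λ y → F y * Σ[ y , h ⟩ ψ) + Σ< h (λ y → F y * ψ h) + F h * ψ h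
    ≡⟨ cong₂ (λ a b → a + b + F h * ψ h) (Σ-adjoint h F ψ) (Σ<-*ʳ h (ψ h) F) ⟩
  Σ< h (λ x → Σ< (suc x) F * ψ x) + Σ< h F * ψ h + F h * ψ h
    ≡⟨ +-assoc (Σ< h (λ x → Σ< (suc x) F * ψ x)) (Σ< h F * ψ h) _ ⟩
  Σ< h (λ x → Σ< (suc x) F * ψ x) + (Σ< h F * ψ h + F h * ψ h)
    ≡⟨ cong (Σ< h (λ x → Σ< (suc x) F * ψ x) +_) (*-distribʳ-+ (ψ h) (Σ< h F) (F h)) ⟨
  Σ< h (λ x → Σ< (suc x) F * ψ x) + (Σ< h F + F h) * ψ h ∎
  where open ≡-Reasoning

-- Slowly decaying weights have a large mean

-- Test function min(d+1, 2M): summed against the hypothesis it gives 12M·M ≤ 12M·E[d].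
module Spread (M q : ℕ) .{{_ : NonZero M}} (q-large : 20 * (M * M) ≤ q) where

  open ≤-Reasoning

  private
    K A : ℕ
    K = M + M
    A = 12 * M

    g : ℕ → ℕ
    g d = suc d ⊓ K

    b : ℕ → ℕ
    b zero    = 0
    b (suc d) = g d * (q + d + 2)

    1≤M : 1 ≤ M
    1≤M = >-nonZero⁻¹ M

    -- After summation by parts the tested hypothesis says that the coefficients g d * q - g d * d -
    -- b d, summed against the weights, give at most 0; each of them is at least A * (M - d). Below
    -- `K` the unit increase of `g` leaves one spare q, which pays for 2K² + 12M² = 20M². From `K`
    -- on `g` is flat and A * d pays alone, with 12 = 4 + 2 + 6.
    coefficients : ∀ d → b d + g d * d + A * M ≤ g d * q + A * d
    coefficients zero = begin
      g 0 * 0 + A * M      ≡⟨ cong (_+ A * M) (*-zeroʳ (g 0)) ⟩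
      12 * M * M           ≡⟨ *-assoc 12 M M ⟩
      12 * (M * M)         ≤⟨ *-monoˡ-≤ (M * M) {12} {20} (m≤m+n 12 8) ⟩
      20 * (M * M)         ≤⟨ q-large ⟩
      q                    ≡⟨ *-identityˡ q ⟨
      1 * q                ≡⟨ cong (_* q) (m≤n⇒m⊓n≡m (≤-trans 1≤M (m≤m+n M M))) ⟨
      g 0 * q              ≤⟨ m≤m+n _ _ ⟩
      g 0 * q + A * 0      ∎
    coefficients (suc e) with suc e <? K
    ... | yes d<K = begin
      g e * (q + e + 2) + g (suc e) * suc e + A * M
        ≡⟨ cong₂ (λ u v → u * (q + e + 2) + v * suc e + A * M) (m≤n⇒m⊓n≡m (<⇒≤ d<K)) (m≤n⇒m⊓n≡m d<K) ⟩
      suc e * (q + e + 2) + suc (suc e) * suc e + A * M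
        ≡⟨ lhs q e M ⟩
      suc e * q + (2 * (suc e * suc (suc e)) + 12 * (M * M))
        ≤⟨ +-monoʳ-≤ (suc e * q) (+-monoˡ-≤ (12 * (M * M)) (*-monoʳ-≤ 2 (*-mono-≤ (<⇒≤ d<K) d<K))) ⟩
      suc e * q + (2 * (K * K) + 12 * (M * M))
        ≡⟨ cong (suc e * q +_) (rhs M) ⟩
      suc e * q + 20 * (M * M)
        ≤⟨ +-monoʳ-≤ (suc e * q) q-large ⟩
      suc e * q + q
        ≡⟨ +-comm (suc e * q) q ⟩
      suc (suc e) * q
        ≡⟨ cong (_* q) (m≤n⇒m⊓n≡m d<K) ⟨
      g (suc e) * q
        ≤⟨ m≤m+n _ _ ⟩
      g (suc e) * q + A * suc e ∎
      where
      lhs : ∀ q e M → suc e * (q + e + 2) + suc (suc e) * suc e + 12 * M * M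
                    ≡ suc e * q + (2 * (suc e * suc (suc e)) + 12 * (M * M))
      lhs = solve-∀
      rhs : ∀ M → 2 * ((M + M) * (M + M)) + 12 * (M * M) ≡ 20 * (M * M)
      rhs = solve-∀
    ... | no  d≮K = begin
      g e * (q + e + 2) + g (suc e) * d + A * M
        ≤⟨ +-monoˡ-≤ (A * M) (+-mono-≤ (*-monoˡ-≤ (q + e + 2) (m⊓n≤n (suc e) K))
                                       (*-monoˡ-≤ d (m⊓n≤n (suc d) K))) ⟩
      K * (q + e + 2) + K * d + A * M
        ≡⟨ lhs q e M ⟩
      K * q + (4 * M * d + 2 * M * 1 + 6 * M * K)
        ≤⟨ +-monoʳ-≤ (K * q) (+-mono-≤ (+-monoʳ-≤ (4 * M * d) (*-monoʳ-≤ (2 * M) {1} {d} (s≤s z≤n)))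
                                       (*-monoʳ-≤ (6 * M) K≤d)) ⟩
      K * q + (4 * M * d + 2 * M * d + 6 * M * d)
        ≡⟨ cong (K * q +_) (rhs M d) ⟩
      K * q + A * d
        ≡⟨ cong (λ u → u * q + A * d) (m≥n⇒m⊓n≡n (m≤n⇒m≤1+n K≤d)) ⟨
      g d * q + A * d ∎
      where
      d = suc e
      K≤d : K ≤ suc e
      K≤d = ≮⇒≥ d≮K
      lhs : ∀ q e M → (M + M) * (q + e + 2) + (M + M) * suc e + 12 * M * M
                    ≡ (M + M) * q + (4 * M * suc e + 2 * M * 1 + 6 * M * (M + M))
      lhs = solve-∀
      rhs : ∀ M d → 4 * M * d + 2 * M * d + 6 * M * d ≡ 12 * M * d
      rhs = solve-∀

  spread : ∀ R (w : ℕ → ℕ) → q ≤ R →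
    (∀ {d} → d < R → q * w d ≤ (q + d + 2) * w (suc d) + d * w d) →
    M * Σ< (suc R) w ≤ Σ< (suc R) (λ d → d * w d)
  spread R w q≤R decay = *-cancelˡ-≤ A {{m*n≢0 12 M}} (begin
    A * (M * Σ< (suc R) w)      ≡⟨ *-assoc A M _ ⟨
    A * M * Σ< (suc R) w        ≤⟨ +-cancelˡ-≤ (S bw + S gdw) _ _ total ⟩
    A * Σ< (suc R) (λ d → d * w d) ∎)
    where
    S : (ℕ → ℕ) → ℕ
    S = Σ< (suc R)
    bw gdw gqw : ℕ → ℕ
    bw  d = b d * w d
    gdw d = g d * (d * w d)
    gqw d = g d * (q * w d)

    tested : S gqw ≤ S bw + S gdw
    tested = begin
      Σ< R gqw + gqw R
        -- The hypothesis stops before `R`; the last term needs no successor because q ≤ R.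
        ≤⟨ +-mono-≤ (Σ<-mono R step) (*-monoʳ-≤ (g R) (*-monoˡ-≤ (w R) q≤R)) ⟩
      Σ< R (λ d → bw (suc d) + gdw d) + gdw R
        ≡⟨ cong (_+ gdw R) (Σ<-+ R (λ d → bw (suc d)) gdw) ⟩
      Σ< R (λ d → bw (suc d)) + Σ< R gdw + gdw R
        ≡⟨ +-assoc _ (Σ< R gdw) (gdw R) ⟩
      Σ< R (λ d → bw (suc d)) + S gdw
        ≡⟨ cong (_+ S gdw) (Σ<-head R bw) ⟨
      S bw + S gdw ∎
      where
      step : ∀ {d} → d < R → gqw d ≤ bw (suc d) + gdw d
      step {d} d<R = begin
        g d * (q * w d)                                    ≤⟨ *-monoʳ-≤ (g d) (decay d<R) ⟩
        g d * ((q + d + 2) * w (suc d) + d * w d)          ≡⟨ *-distribˡ-+ (g d) _ (d * w d) ⟩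
        g d * ((q + d + 2) * w (suc d)) + gdw d            ≡⟨ cong (_+ gdw d) (*-assoc (g d) (q + d + 2) _) ⟨
        bw (suc d) + gdw d                                 ∎

    weighted : ∀ {d} → bw d + gdw d + A * M * w d ≤ gqw d + A * (d * w d)
    weighted {d} = begin
      bw d + gdw d + A * M * w d             ≡⟨ lhs (b d) (g d) d (A * M) (w d) ⟩
      (b d + g d * d + A * M) * w d          ≤⟨ *-monoˡ-≤ (w d) (coefficients d) ⟩
      (g d * q + A * d) * w d                ≡⟨ rhs (g d) q A d (w d) ⟩
      gqw d + A * (d * w d)                  ∎
      where
      lhs : ∀ b g d c w → b * w + g * (d * w) + c * w ≡ (b + g * d + c) * w
      lhs = solve-∀
      rhs : ∀ g q a d w → (g * q + a * d) * w ≡ g * (q * w) + a * (d * w)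
      rhs = solve-∀

    total : S bw + S gdw + A * M * S w ≤ S bw + S gdw + A * S (λ d → d * w d)
    total = begin
      S bw + S gdw + A * M * S w
        ≡⟨ cong₂ _+_ (Σ<-+ (suc R) bw gdw) (Σ<-*ˡ (suc R) (A * M) w) ⟨
      S (λ d → bw d + gdw d) + S (λ d → A * M * w d)
        ≡⟨ Σ<-+ (suc R) (λ d → bw d + gdw d) _ ⟨
      S (λ d → bw d + gdw d + A * M * w d)
        ≤⟨ Σ<-mono (suc R) (λ _ → weighted) ⟩
      S (λ d → gqw d + A * (d * w d))
        ≡⟨ Σ<-+ (suc R) gqw _ ⟩
      S gqw + S (λ d → A * (d * w d))
        ≡⟨ cong (S gqw +_) (Σ<-*ˡ (suc R) A _) ⟩
      S gqw + A * S (λ d → d * w d)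
        ≤⟨ +-monoˡ-≤ _ tested ⟩
      S bw + S gdw + A * S (λ d → d * w d) ∎

-- Growth rates of iterated sums

-- G summed n times has G (r − s) growing in s at least as fast as s ↦ C(n − 1 + s, s),
-- the case of a unit mass at r.
module Upward (r : ℕ) where

  open ≤-Reasoning

  T : (ℕ → ℕ) → ℕ → ℕ
  T ψ x = Σ[ x , suc r ⟩ ψ

  Growth : ℕ → (ℕ → ℕ) → Set
  Growth n ψ = ∀ x s → suc x + s ≡ r → (n + s) * ψ (suc x) ≤ suc s * ψ x

  T-head : ∀ {ψ x s} → x + s ≡ r → T ψ x ≡ ψ x + T ψ (suc x)
  T-head {ψ} {x} {s} eq = Σ[⟩-head ψ (s≤s (m+n≤o⇒m≤o x (≤-reflexive eq)))

  growth-base : ∀ ψ → Growth 1 (T ψ)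
  growth-base ψ x s eq = *-monoʳ-≤ (suc s) (begin
    T ψ (suc x)         ≤⟨ m≤n+m _ (ψ x) ⟩
    ψ x + T ψ (suc x)   ≡⟨ T-head {ψ} {x} {suc s} (trans (+-suc x s) eq) ⟨
    T ψ x               ∎)

  -- Induction on the distance s to `r`: the growth bound at x absorbs the further term of the sum.
  -- For the binomial sequence it is an equality, the hockey-stick identity.
  growth-sum : ∀ {n ψ} → Growth n ψ → ∀ x s → suc x + s ≡ r → n * T ψ (suc x) ≤ suc s * ψ x
  growth-sum {n} {ψ} G x zero eq = begin
    n * T ψ (suc x)      ≡⟨ cong (n *_) (top (trans (sym (+-identityʳ (suc x))) eq)) ⟩
    n * ψ (suc x)        ≡⟨ cong (_* ψ (suc x)) (+-identityʳ n) ⟨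
    (n + 0) * ψ (suc x)  ≤⟨ G x 0 eq ⟩
    1 * ψ x              ∎
    where
    top : ∀ {y} → y ≡ r → T ψ y ≡ ψ y
    top refl = Σ[⟩-singleton ψ r
  growth-sum {n} {ψ} G x (suc s) eq = begin
    n * T ψ (suc x)                              ≡⟨ cong (n *_) (T-head {ψ} {suc x} {suc s} eq) ⟩
    n * (ψ (suc x) + T ψ (suc (suc x)))          ≡⟨ *-distribˡ-+ n (ψ (suc x)) _ ⟩
    n * ψ (suc x) + n * T ψ (suc (suc x))        ≤⟨ +-monoʳ-≤ (n * ψ (suc x)) (growth-sum {n} {ψ} G (suc x) s (trans (sym (+-suc (suc x) s)) eq)) ⟩
    n * ψ (suc x) + suc s * ψ (suc x)            ≡⟨ *-distribʳ-+ (ψ (suc x)) n (suc s) ⟨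
    (n + suc s) * ψ (suc x)                      ≤⟨ G x (suc s) eq ⟩
    suc (suc s) * ψ x                            ∎

  growth-step : ∀ {n ψ} → Growth n ψ → Growth (suc n) (T ψ)
  growth-step {n} {ψ} G x s eq = begin
    (suc n + s) * T ψ (suc x)                  ≡⟨ cong (_* T ψ (suc x)) (+-suc n s) ⟨
    (n + suc s) * T ψ (suc x)                  ≡⟨ *-distribʳ-+ (T ψ (suc x)) n (suc s) ⟩
    n * T ψ (suc x) + suc s * T ψ (suc x)      ≤⟨ +-monoˡ-≤ _ (growth-sum {n} {ψ} G x s eq) ⟩
    suc s * ψ x + suc s * T ψ (suc x)          ≡⟨ *-distribˡ-+ (suc s) (ψ x) _ ⟨
    suc s * (ψ x + T ψ (suc x))                ≡⟨ cong (suc s *_) (T-head {ψ} {x} {suc s} (trans (+-suc x s) eq)) ⟨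
    suc s * T ψ x                              ∎

-- Beyond r₀, partial sums iterated n + 1 times of a sequence supported up to r₀ grow at
-- most as fast as t ↦ C(n + t, t), the case of a unit mass at r₀.
module Downward (r₀ hi : ℕ) where

  open ≤-Reasoning

  C : (ℕ → ℕ) → ℕ → ℕ
  C F x = Σ< (suc x) F

  Decay : ℕ → (ℕ → ℕ) → Set
  Decay n F = ∀ t → r₀ + suc t ≤ hi → suc t * F (r₀ + suc t) ≤ (n + suc t) * F (r₀ + t)

  -- `Decay` looks no further than `hi`, so it survives cutting a sequence off above the ceiling of
  -- a block.
  decay-resp : ∀ {n F F′} → (∀ {x} → x ≤ hi → F x ≡ F′ x) → Decay n F → Decay n F′
  decay-resp {n} eq D t le = subst₂ _≤_
    (cong (suc t *_) (eq le))
    (cong ((n + suc t) *_) (eq (≤-trans (+-monoʳ-≤ r₀ (n≤1+n t)) le)))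
    (D t le)

  C-last : ∀ F t → C F (r₀ + suc t) ≡ C F (r₀ + t) + F (r₀ + suc t)
  C-last F t rewrite +-suc r₀ t = refl

  decay-base : ∀ {E} → (∀ {x} → r₀ < x → E x ≡ 0) → Decay 0 (C E)
  decay-base {E} zeros t le = ≤-reflexive (cong (suc t *_)
    (trans (C-last E t) (trans (cong (C E (r₀ + t) +_) (zeros (m<m+n r₀ z<s))) (+-identityʳ _))))

  -- Mirror image of the hockey-stick argument. The start t = 0 discards the mass of `F` below `r₀`,
  -- which only helps; a unit mass at `r₀` is the extreme case.
  decay-sum : ∀ {n F} → Decay n F → ∀ t → r₀ + suc t ≤ hi →
    suc t * F (r₀ + suc t) ≤ suc n * C F (r₀ + t)
  decay-sum {n} {F} D zero le = begin
    1 * F (r₀ + 1)          ≤⟨ D 0 le ⟩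
    (n + 1) * F (r₀ + 0)    ≡⟨ cong (_* F (r₀ + 0)) (+-comm n 1) ⟩
    suc n * F (r₀ + 0)      ≤⟨ *-monoʳ-≤ (suc n) (m≤n+m _ _) ⟩
    suc n * C F (r₀ + 0)    ∎
  decay-sum {n} {F} D (suc t) le = begin
    suc (suc t) * F (r₀ + suc (suc t))                  ≤⟨ D (suc t) le ⟩
    (n + suc (suc t)) * F (r₀ + suc t)                  ≡⟨ cong (_* F (r₀ + suc t)) (+-suc n (suc t)) ⟩
    (suc n + suc t) * F (r₀ + suc t)                    ≡⟨ *-distribʳ-+ (F (r₀ + suc t)) (suc n) (suc t) ⟩
    suc n * F (r₀ + suc t) + suc t * F (r₀ + suc t)     ≤⟨ +-monoʳ-≤ (suc n * F (r₀ + suc t)) (decay-sum {n} {F} D t (≤-trans (+-monoʳ-≤ r₀ (n≤1+n (suc t))) le)) ⟩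
    suc n * F (r₀ + suc t) + suc n * C F (r₀ + t)       ≡⟨ +-comm (suc n * F (r₀ + suc t)) _ ⟩
    suc n * C F (r₀ + t) + suc n * F (r₀ + suc t)       ≡⟨ *-distribˡ-+ (suc n) (C F (r₀ + t)) _ ⟨
    suc n * (C F (r₀ + t) + F (r₀ + suc t))             ≡⟨ cong (suc n *_) (C-last F t) ⟨
    suc n * C F (r₀ + suc t)                            ∎

  decay-step : ∀ {n F} → Decay n F → Decay (suc n) (C F)
  decay-step {n} {F} D t le = begin
    suc t * C F (r₀ + suc t)                        ≡⟨ cong (suc t *_) (C-last F t) ⟩
    suc t * (C F (r₀ + t) + F (r₀ + suc t))         ≡⟨ *-distribˡ-+ (suc t) (C F (r₀ + t)) _ ⟩
    suc t * C F (r₀ + t) + suc t * F (r₀ + suc t)   ≤⟨ +-monoʳ-≤ (suc t * C F (r₀ + t)) (decay-sum {n} {F} D t le) ⟩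
    suc t * C F (r₀ + t) + suc n * C F (r₀ + t)     ≡⟨ *-distribʳ-+ (C F (r₀ + t)) (suc t) (suc n) ⟨
    (suc t + suc n) * C F (r₀ + t)                  ≡⟨ cong (_* C F (r₀ + t)) (+-comm (suc t) (suc n)) ⟩
    (suc n + suc t) * C F (r₀ + t)                  ∎

-- Enumeration and counting of lattice paths

interval : ℕ → ℕ → List ℕ
interval lo hi = applyUpTo (lo +_) (suc hi ∸ lo)

∈-interval⁺ : ∀ {lo hi x} → lo ≤ x → x ≤ hi → x ∈ interval lo hi
∈-interval⁺ {lo} {hi} lo≤x x≤hi = subst (_∈ interval lo hi) (m+[n∸m]≡n lo≤x)
  (∈-applyUpTo⁺ (lo +_) (∸-monoˡ-< (s≤s x≤hi) lo≤x))

∈-interval⁻ : ∀ {lo hi x} → x ∈ interval lo hi → lo ≤ x × x ≤ hi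
∈-interval⁻ {lo} {hi} x∈ with i , i< , refl ← ∈-applyUpTo⁻ (lo +_) x∈ =
  m≤m+n lo i , s≤s⁻¹ (subst (lo + i <_) (m+[n∸m]≡n lo≤) (+-monoʳ-< lo i<))
  where
  lo≤ : lo ≤ suc hi
  lo≤ = <⇒≤ (m∸n≢0⇒n<m (λ eq → contradiction (subst (i <_) eq i<) (λ ())))

interval-unique : ∀ lo hi → Unique (interval lo hi)
interval-unique lo hi = Unique.applyUpTo⁺₁ (lo +_) (suc hi ∸ lo)
  (λ {i} {j} i<j _ eq → <⇒≢ i<j (+-cancelˡ-≡ lo i j eq))

sum-applyUpTo : ∀ (f : ℕ → ℕ) g n → sum (map f (applyUpTo g n)) ≡ Σ< n (f ∘ g)
sum-applyUpTo f g zero    = refl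
sum-applyUpTo f g (suc n) = trans (cong (f (g 0) +_) (sum-applyUpTo f (g ∘ suc) n))
  (sym (Σ<-head n (f ∘ g)))

sum-interval : ∀ f lo hi → sum (map f (interval lo hi)) ≡ Σ[ lo , suc hi ⟩ f
sum-interval f lo hi = sum-applyUpTo f (lo +_) (suc hi ∸ lo)

sum-concatMap : ∀ {A : Set} (φ : A → ℕ) (f : ℕ → List A) xs →
  sum (map φ (concatMap f xs)) ≡ sum (map (λ x → sum (map φ (f x))) xs)
sum-concatMap φ f []       = refl
sum-concatMap φ f (x ∷ xs) = begin
  sum (map φ (f x List.++ concatMap f xs))            ≡⟨ cong sum (map-++ φ (f x) _) ⟩
  sum (map φ (f x) List.++ map φ (concatMap f xs))    ≡⟨ sum-++ (map φ (f x)) _ ⟩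
  sum (map φ (f x)) + sum (map φ (concatMap f xs)) ≡⟨ cong (sum (map φ (f x)) +_) (sum-concatMap φ f xs) ⟩
  sum (map φ (f x)) + sum (map (λ y → sum (map φ (f y))) xs) ∎
  where open ≡-Reasoning

sum-const : ∀ {A : Set} c (xs : List A) → sum (map (λ _ → c) xs) ≡ length xs * c
sum-const c []       = refl
sum-const c (x ∷ xs) = cong (c +_) (sum-const c xs)

module Paths (ρ : ℕ → ℕ) where

  data IsPath : ∀ {n} → ℕ → ℕ → Vec ℕ n → Set where
    []  : ∀ {c lo} → IsPath c lo []
    _∷_ : ∀ {n c lo x} {xs : Vec ℕ n} →
          lo ≤ x × x ≤ ρ c → IsPath (suc c) x xs → IsPath c lo (x ∷ xs)

  paths : ∀ n → ℕ → ℕ → List (Vec ℕ n)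
  paths zero    c lo = [] ∷ []
  paths (suc n) c lo = concatMap (λ x → map (x ∷_) (paths n (suc c) x)) (interval lo (ρ c))

  ∈-paths⁺ : ∀ {n c lo} {xs : Vec ℕ n} → IsPath c lo xs → xs ∈ paths n c lo
  ∈-paths⁺ []                        = here refl
  ∈-paths⁺ {suc n} {c} (_∷_ {x = x} (lo≤x , x≤ρ) path) =
    ∈-concatMap⁺ (λ x → map (x ∷_) (paths n (suc c) x))
      (lose (∈-interval⁺ lo≤x x≤ρ) (∈-map⁺ (x ∷_) (∈-paths⁺ path)))

  ∈-paths⁻ : ∀ {n c lo} {xs : Vec ℕ n} → xs ∈ paths n c lo → IsPath c lo xs
  ∈-paths⁻ {zero}  {xs = []} _ = []
  ∈-paths⁻ {suc n} {c} {lo} {xs} xs∈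
    with x , x∈ , xs∈′ ← find (∈-concatMap⁻ (λ x → map (x ∷_) (paths n (suc c) x)) {xs = interval lo (ρ c)} xs∈)
    with ys , ys∈ , refl ← ∈-map⁻ (x ∷_) xs∈′
    = ∈-interval⁻ x∈ ∷ ∈-paths⁻ ys∈

  paths-unique : ∀ n c lo → Unique (paths n c lo)
  paths-unique zero    c lo = [] ∷ []
  paths-unique (suc n) c lo = Unique.concat⁺
    (All-map⁺ (All.universal (λ x → Unique.map⁺ ∷-injectiveʳ (paths-unique n (suc c) x)) _))
    (AllPairsₚ.map⁺ (AllPairs.map disjoint (interval-unique lo (ρ c))))
    where
    disjoint : ∀ {x y} → x ≢ y →
      Disjoint (map (x ∷_) (paths n (suc c) x)) (map (y ∷_) (paths n (suc c) y))
    disjoint x≢y (p , q) with _ , _ , refl ← ∈-map⁻ _ p with _ , _ , eq ← ∈-map⁻ _ q =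
      x≢y (∷-injectiveˡ eq)

  #paths : ℕ → ℕ → ℕ → ℕ
  #paths zero    c lo = 1
  #paths (suc n) c lo = Σ[ lo , suc (ρ c) ⟩ (#paths n (suc c))

  -- Applied to ψ, the sum of ψ(x_k) over the sequences x₀ ≤ ⋯ ≤ x_k.
  transfer : ℕ → ℕ → (ℕ → ℕ) → ℕ → ℕ
  transfer zero    c ψ lo = Σ[ lo , suc (ρ c) ⟩ ψ
  transfer (suc k) c ψ lo = Σ[ lo , suc (ρ c) ⟩ (transfer k (suc c) ψ)

  sum-paths-suc : ∀ {n} c lo (φ : Vec ℕ (suc n) → ℕ) →
    sum (map φ (paths (suc n) c lo))
      ≡ Σ[ lo , suc (ρ c) ⟩ (λ x → sum (map (λ xs → φ (x ∷ xs)) (paths n (suc c) x)))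
  sum-paths-suc {n} c lo φ = begin
    sum (map φ (paths (suc n) c lo))
      ≡⟨ sum-concatMap φ (λ x → map (x ∷_) (paths n (suc c) x)) (interval lo (ρ c)) ⟩
    sum (map (λ x → sum (map φ (map (x ∷_) (paths n (suc c) x)))) (interval lo (ρ c)))
      ≡⟨ cong sum (map-cong (λ x → cong sum (sym (map-∘ (paths n (suc c) x)))) (interval lo (ρ c))) ⟩
    sum (map (λ x → sum (map (λ xs → φ (x ∷ xs)) (paths n (suc c) x))) (interval lo (ρ c)))
      ≡⟨ sum-interval _ lo (ρ c) ⟩
    Σ[ lo , suc (ρ c) ⟩ (λ x → sum (map (λ xs → φ (x ∷ xs)) (paths n (suc c) x))) ∎
    where open ≡-Reasoning

  Σ[⟩-cong : ∀ lo hi {f g} → (∀ x → f x ≡ g x) → Σ[ lo , hi ⟩ f ≡ Σ[ lo , hi ⟩ g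
  Σ[⟩-cong lo hi eq = Σ<-cong (hi ∸ lo) (λ {j} _ → eq (lo + j))

  sum-ones≡#paths : ∀ n c lo → sum (map (λ _ → 1) (paths n c lo)) ≡ #paths n c lo
  sum-ones≡#paths zero    c lo = refl
  sum-ones≡#paths (suc n) c lo = trans (sum-paths-suc c lo (λ _ → 1))
    (Σ[⟩-cong lo (suc (ρ c)) (sum-ones≡#paths n (suc c)))

  length-paths : ∀ n c lo → length (paths n c lo) ≡ #paths n c lo
  length-paths n c lo = trans (sym (*-identityʳ _))
    (trans (sym (sum-const 1 (paths n c lo))) (sum-ones≡#paths n c lo))

  -- Only column k is tested, so the columns after it contribute just their number of continuations,
  -- as a weight.
  sum-at : ∀ (φ : ℕ → ℕ) {n} (k : Fin n) c lo →
    sum (map (λ xs → φ (lookup xs k)) (paths n c lo))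
      ≡ transfer (toℕ k) c (λ x → φ x * #paths (n ∸ suc (toℕ k)) (suc c + toℕ k) x) lo
  sum-at φ {suc n} fzero c lo = trans (sum-paths-suc c lo _) (Σ[⟩-cong lo (suc (ρ c)) at-head)
    where
    at-head : ∀ x → sum (map (λ _ → φ x) (paths n (suc c) x)) ≡ φ x * #paths n (suc c + 0) x
    at-head x rewrite +-identityʳ c | sum-const (φ x) (paths n (suc c) x) | length-paths n (suc c) x
      = *-comm _ (φ x)
  sum-at φ {suc n} (fsuc k) c lo = trans (sum-paths-suc c lo _) (Σ[⟩-cong lo (suc (ρ c)) in-tail)
    where
    in-tail : ∀ x → sum (map (λ xs → φ (lookup xs k)) (paths n (suc c) x))
      ≡ transfer (toℕ k) (suc c) (λ x → φ x * #paths (n ∸ suc (toℕ k)) (suc c + suc (toℕ k)) x) x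
    in-tail x rewrite +-suc c (toℕ k) = sum-at φ k (suc c) x

  -- reaching c y is the number of sequences x₀ ≤ ⋯ ≤ x_{c-1} = y.
  reaching : ℕ → ℕ → ℕ
  reaching zero    zero    = 1
  reaching zero    (suc y) = 0
  reaching (suc c) y with y ≤? ρ c
  ... | yes _ = Σ< (suc y) (reaching c)
  ... | no  _ = 0

  reaching-≤ : ∀ {c y} → y ≤ ρ c → reaching (suc c) y ≡ Σ< (suc y) (reaching c)
  reaching-≤ {c} {y} y≤ρ with y ≤? ρ c
  ... | yes _   = refl
  ... | no  y≰ρ = contradiction y≤ρ y≰ρ

  reaching-> : ∀ {c y} → ρ c < y → reaching (suc c) y ≡ 0
  reaching-> {c} {y} ρ<y with y ≤? ρ c
  ... | yes y≤ρ = contradiction ρ<y (≤⇒≯ y≤ρ)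
  ... | no  _   = refl

  module _ (ρ-mono : ∀ {i j} → i ≤ j → ρ i ≤ ρ j) where

    -- Columns pass one at a time from `transfer` to `reaching` by `Σ-adjoint`. The upper limit may
    -- then rise to that of the next column, since `reaching (suc c)` vanishes above ρ c.
    reaching-transfer : ∀ k c ψ →
      Σ< (suc (ρ c)) (λ y → reaching c y * transfer k c ψ y)
        ≡ Σ< (suc (ρ (c + k))) (λ x → Σ< (suc x) (reaching (c + k)) * ψ x)
    reaching-transfer zero    c ψ rewrite +-identityʳ c = Σ-adjoint (suc (ρ c)) (reaching c) ψ
    reaching-transfer (suc k) c ψ = begin
      Σ< (suc (ρ c)) (λ y → reaching c y * Σ[ y , suc (ρ c) ⟩ (transfer k (suc c) ψ))
        ≡⟨ Σ-adjoint (suc (ρ c)) (reaching c) (transfer k (suc c) ψ) ⟩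
      Σ< (suc (ρ c)) (λ x → Σ< (suc x) (reaching c) * transfer k (suc c) ψ x)
        ≡⟨ Σ<-cong (suc (ρ c)) (λ {x} x< → cong (_* transfer k (suc c) ψ x) (reaching-≤ (s≤s⁻¹ x<))) ⟨
      Σ< (suc (ρ c)) (λ x → reaching (suc c) x * transfer k (suc c) ψ x)
        ≡⟨ Σ<-extend _ (s≤s (ρ-mono (n≤1+n c))) (λ {x} ρ<x → cong (_* transfer k (suc c) ψ x) (reaching-> ρ<x)) ⟨
      Σ< (suc (ρ (suc c))) (λ x → reaching (suc c) x * transfer k (suc c) ψ x)
        ≡⟨ reaching-transfer k (suc c) ψ ⟩
      Σ< (suc (ρ (suc c + k))) (λ x → Σ< (suc x) (reaching (suc c + k)) * ψ x)
        ≡⟨ cong (λ i → Σ< (suc (ρ i)) (λ x → Σ< (suc x) (reaching i) * ψ x)) (+-suc c k) ⟨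
      Σ< (suc (ρ (c + suc k))) (λ x → Σ< (suc x) (reaching (c + suc k)) * ψ x) ∎
      where open ≡-Reasoning

    transfer-from-0 : ∀ k ψ →
      transfer k 0 ψ 0 ≡ Σ< (suc (ρ k)) (λ x → Σ< (suc x) (reaching k) * ψ x)
    transfer-from-0 k ψ = begin
      -- `reaching 0` is a unit mass at height 0, so only one starting height contributes.
      transfer k 0 ψ 0                                              ≡⟨ +-identityʳ _ ⟨
      Σ< 1 (λ y → reaching 0 y * transfer k 0 ψ y)                  ≡⟨ Σ<-extend {1} {suc (ρ 0)} (λ y → reaching 0 y * transfer k 0 ψ y) (s≤s z≤n) (λ { (s≤s _) → refl }) ⟨
      Σ< (suc (ρ 0)) (λ y → reaching 0 y * transfer k 0 ψ y)        ≡⟨ reaching-transfer k 0 ψ ⟩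
      Σ< (suc (ρ k)) (λ x → Σ< (suc x) (reaching k) * ψ x)          ∎
      where open ≡-Reasoning

    -- The mean deficit at a corner

    -- The deficit ρ k − x_k is studied at the last column k = c₀ + p′ of the first of two
    -- consecutive blocks of suc p′ columns; no path enters the first block above r₀.
    module Corner (c₀ p′ r₀ q M : ℕ) .{{_ : NonZero M}}
      (q-large : 20 * (M * M) ≤ q)
      (entry  : ∀ {y} → r₀ < y → reaching c₀ y ≡ 0)
      (block  : ∀ {j} → j ≤ p′ → ρ (c₀ + j) ≡ r₀ + q)
      (block′ : ∀ {j} → j ≤ p′ → ρ (suc (c₀ + p′) + j) ≡ r₀ + q + suc q)
      (n : ℕ)
      where

      private
        r = r₀ + q
        k = c₀ + p′
        module D = Downward r₀ r
        module U = Upward (r + suc q)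

        -- For x ≤ r, `F x` counts the initial parts ending at x in column `k` and `G x` their
        -- continuations, so for d ≤ r `w d` counts the paths with deficit d.
        F G w : ℕ → ℕ
        F x = Σ< (suc x) (reaching k)
        G x = #paths (suc p′ + n) (suc k) x
        w d = F (r ∸ d) * G (r ∸ d)

      -- `entry` confines `reaching c₀` to heights up to `r₀`; each column of the block then applies
      -- one more partial sum, cut off at the common ceiling `r`.
      decay-in-block : ∀ j → j ≤ p′ → D.Decay j (D.C (reaching (c₀ + j)))
      decay-in-block zero    _    = D.decay-base (λ {x} lt →
        trans (cong (λ c → reaching c x) (+-identityʳ c₀)) (entry lt))
      decay-in-block (suc j) j<p′ = subst (λ c → D.Decay (suc j) (D.C (reaching c))) (sym (+-suc c₀ j))
        (D.decay-step {j} {reaching (suc (c₀ + j))}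
          (D.decay-resp {j} {D.C (reaching (c₀ + j))} {reaching (suc (c₀ + j))}
            (λ x≤r → sym (reaching-≤ (subst (_ ≤_) (sym (block (<⇒≤ j<p′))) x≤r)))
            (decay-in-block j (<⇒≤ j<p′))))

      -- Each column of the next block sums once more up to the same ceiling. Whatever follows that
      -- block enters only as the arbitrary sequence that is summed.
      growth-in-block : ∀ j c → (∀ {i} → i ≤ j → ρ (c + i) ≡ r + suc q) →
        U.Growth (suc j) (#paths (suc j + n) c)
      growth-in-block zero c top =
        subst (λ h → U.Growth 1 (λ x → Σ[ x , suc h ⟩ (#paths n (suc c))))
          (sym (trans (cong ρ (sym (+-identityʳ c))) (top z≤n)))
          (U.growth-base (#paths n (suc c)))
      growth-in-block (suc j) c top =
        subst (λ h → U.Growth (suc (suc j)) (λ x → Σ[ x , suc h ⟩ (#paths (suc j + n) (suc c))))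
          (sym (trans (cong ρ (sym (+-identityʳ c))) (top z≤n)))
          (U.growth-step {suc j} {#paths (suc j + n) (suc c)}
            (growth-in-block j (suc c) (λ {i} i≤j → trans (cong ρ (sym (+-suc c i))) (top (s≤s i≤j)))))

      open ≤-Reasoning

      F-decay : D.Decay p′ F
      F-decay = decay-in-block p′ ≤-refl

      G-growth : U.Growth (suc p′) G
      G-growth = growth-in-block p′ (suc k) block′

      -- Deficit d means height t + 1 = q - d above `r₀` and distance q + d + 1 below the next
      -- ceiling. The two rates give F₁/F₀ ≤ (p′ + t + 1)/(t + 1) and G₁/G₀ ≤ (q + d + 2)/(p′ + q +
      -- d + 2). Since t < q, the second denominator may be lowered to p′ + t + 1, which cancels.
      ratio : ∀ t d → suc t + d ≡ q →
        suc t * (F (r₀ + suc t) * G (r₀ + suc t)) ≤ (q + d + 2) * (F (r₀ + t) * G (r₀ + t))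
      ratio t d eq = *-cancelˡ-≤ (p′ + suc t) {{≢-nonZero (λ e → contradiction (m+n≡0⇒n≡0 p′ e) (λ ()))}} (begin
        (p′ + suc t) * (suc t * (F₁ * G₁))                ≡⟨ lhs (p′ + suc t) (suc t) F₁ G₁ ⟩
        (suc t * F₁) * ((p′ + suc t) * G₁)                ≤⟨ *-mono-≤ (F-decay t (+-monoʳ-≤ r₀ t≤q)) G-bound ⟩
        ((p′ + suc t) * F₀) * ((q + d + 2) * G₀)          ≡⟨ rhs (p′ + suc t) (q + d + 2) F₀ G₀ ⟩
        (p′ + suc t) * ((q + d + 2) * (F₀ * G₀))          ∎)
        where
        F₁ = F (r₀ + suc t)
        G₁ = G (r₀ + suc t)
        F₀ = F (r₀ + t)
        G₀ = G (r₀ + t)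
        t≤q : suc t ≤ q
        t≤q = m+n≤o⇒m≤o (suc t) (≤-reflexive eq)
        lhs : ∀ a t f g → a * (t * (f * g)) ≡ (t * f) * (a * g)
        lhs = solve-∀
        rhs : ∀ a b f g → (a * f) * (b * g) ≡ a * (b * (f * g))
        rhs = solve-∀
        shape : ∀ q d → suc (suc q + d) ≡ q + d + 2
        shape = solve-∀
        position : suc (r₀ + t) + (suc q + d) ≡ r + suc q
        position = begin-equality
          suc (r₀ + t) + (suc q + d)     ≡⟨ regroup r₀ t q d ⟩
          r₀ + (suc t + d) + suc q       ≡⟨ cong (λ e → r₀ + e + suc q) eq ⟩
          r + suc q                      ∎
          where
          regroup : ∀ a t q d → suc (a + t) + (suc q + d) ≡ a + (suc t + d) + suc q
          regroup = solve-∀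
        G-bound : (p′ + suc t) * G₁ ≤ (q + d + 2) * G₀
        G-bound = begin
          (p′ + suc t) * G₁                  ≤⟨ *-monoˡ-≤ G₁ (≤-trans (+-monoʳ-≤ p′ (≤-trans t≤q (≤-trans (n≤1+n q) (m≤m+n (suc q) d)))) (n≤1+n _)) ⟩
          (suc p′ + (suc q + d)) * G₁        ≡⟨ cong (λ x → (suc p′ + (suc q + d)) * G x) (+-suc r₀ t) ⟩
          (suc p′ + (suc q + d)) * G (suc (r₀ + t)) ≤⟨ G-growth (r₀ + t) (suc q + d) position ⟩
          suc (suc q + d) * G₀               ≡⟨ cong (_* G₀) (shape q d) ⟩
          (q + d + 2) * G₀                   ∎

      -- Moving d * w d to the right avoids a truncated q - d and makes the range d ≥ q trivial.
      weights : ∀ {d} → d < r → q * w d ≤ (q + d + 2) * w (suc d) + d * w d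
      weights {d} _ with d <? q
      ... | no d≮q = ≤-trans (*-monoˡ-≤ (w d) (≮⇒≥ d≮q)) (m≤n+m _ _)
      ... | yes d<q with t , refl ← m≤n⇒∃[o]m+o≡n d<q = begin
        q * w d                                     ≡⟨ cong (_* w d) split ⟨
        (suc t + d) * w d                           ≡⟨ *-distribʳ-+ (w d) (suc t) d ⟩
        suc t * w d + d * w d                       ≤⟨ +-monoˡ-≤ (d * w d) (subst₂ (λ x y → suc t * (F x * G x) ≤ (q + d + 2) * (F y * G y)) (sym at-d) (sym at-suc-d) (ratio t d split)) ⟩
        (q + d + 2) * w (suc d) + d * w d           ∎
        where
        split : suc t + d ≡ suc d + t
        split = cong suc (+-comm t d)
        at-d : r₀ + (suc d + t) ∸ d ≡ r₀ + suc t
        at-d = trans (cong (λ e → r₀ + e ∸ d) (sym split))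
          (trans (cong (_∸ d) (sym (+-assoc r₀ (suc t) d))) (m+n∸n≡m (r₀ + suc t) d))
        at-suc-d : r₀ + (suc d + t) ∸ suc d ≡ r₀ + t
        at-suc-d = trans (cong (λ e → r₀ + e ∸ suc d) (+-comm (suc d) t))
          (trans (cong (_∸ suc d) (sym (+-assoc r₀ t (suc d)))) (m+n∸n≡m (r₀ + t) (suc d)))

      mean-deficit : Σ< (suc r) (λ x → x * (F x * G x)) + M * Σ< (suc r) (λ x → F x * G x)
                   ≤ r * Σ< (suc r) (λ x → F x * G x)
      mean-deficit = begin
        Σ< (suc r) (λ x → x * u x) + M * Σ< (suc r) u
          ≡⟨ cong₂ (λ a b → a + M * b) (Σ<-reverse r _) (Σ<-reverse r u) ⟩
        Σ< (suc r) (λ d → (r ∸ d) * w d) + M * Σ< (suc r) w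
          ≤⟨ +-monoʳ-≤ _ (Spread.spread M q q-large r w (m≤n+m q r₀) weights) ⟩
        Σ< (suc r) (λ d → (r ∸ d) * w d) + Σ< (suc r) (λ d → d * w d)
          ≡⟨ Σ<-+ (suc r) _ _ ⟨
        Σ< (suc r) (λ d → (r ∸ d) * w d + d * w d)
          ≡⟨ Σ<-cong (suc r) (λ {d} d≤r → trans (sym (*-distribʳ-+ (w d) (r ∸ d) d)) (cong (_* w d) (m∸n+n≡m (s≤s⁻¹ d≤r)))) ⟩
        Σ< (suc r) (λ d → r * w d)
          ≡⟨ Σ<-*ˡ (suc r) r w ⟩
        r * Σ< (suc r) w
          ≡⟨ cong (r *_) (Σ<-reverse r u) ⟨
        r * Σ< (suc r) u ∎
        where
        u : ℕ → ℕ
        u x = F x * G x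

      module _ {N} (κ : Fin N) (κ≡k : toℕ κ ≡ k) (columns : N ≡ suc k + (suc p′ + n)) where

        sum-weighted : ∀ φ → sum (map (λ xs → φ (lookup xs κ)) (paths N 0 0))
          ≡ Σ< (suc r) (λ x → φ x * (F x * G x))
        sum-weighted φ = begin-equality
          sum (map (λ xs → φ (lookup xs κ)) (paths N 0 0))
            ≡⟨ sum-at φ κ 0 0 ⟩
          transfer (toℕ κ) 0 (λ x → φ x * #paths (N ∸ suc (toℕ κ)) (suc (toℕ κ)) x) 0
            ≡⟨ cong (λ i → transfer i 0 (λ x → φ x * #paths (N ∸ suc i) (suc i) x) 0) κ≡k ⟩
          transfer k 0 (λ x → φ x * #paths (N ∸ suc k) (suc k) x) 0
            ≡⟨ cong (λ i → transfer k 0 (λ x → φ x * #paths i (suc k) x) 0) (trans (cong (_∸ suc k) columns) (m+n∸m≡n (suc k) (suc p′ + n))) ⟩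
          transfer k 0 (λ x → φ x * G x) 0
            ≡⟨ transfer-from-0 k (λ x → φ x * G x) ⟩
          Σ< (suc (ρ k)) (λ x → F x * (φ x * G x))
            ≡⟨ cong (λ h → Σ< (suc h) (λ x → F x * (φ x * G x))) (block ≤-refl) ⟩
          Σ< (suc r) (λ x → F x * (φ x * G x))
            ≡⟨ Σ<-cong (suc r) (λ {x} _ → swap (F x) (φ x) (G x)) ⟩
          Σ< (suc r) (λ x → φ x * (F x * G x)) ∎
          where
          swap : ∀ f a g → f * (a * g) ≡ a * (f * g)
          swap = solve-∀

        paths-deficit : sum (map (λ xs → lookup xs κ) (paths N 0 0)) + M * length (paths N 0 0)
                      ≤ r * length (paths N 0 0)
        paths-deficit = subst₂ (λ a b → a + M * b ≤ r * b)
          (sym (sum-weighted (λ x → x)))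
          (begin-equality
            Σ< (suc r) (λ x → F x * G x)               ≡⟨ Σ<-cong (suc r) (λ {x} _ → *-identityˡ (F x * G x)) ⟨
            Σ< (suc r) (λ x → 1 * (F x * G x))         ≡⟨ sum-weighted (λ _ → 1) ⟨
            sum (map (λ _ → 1) (paths N 0 0))          ≡⟨ sum-const 1 (paths N 0 0) ⟩
            length (paths N 0 0) * 1                   ≡⟨ *-identityʳ _ ⟩
            length (paths N 0 0)                       ∎)
          mean-deficit

-- Fractions with a common denominator

toℚᵘ-/ : ∀ i c .{{_ : NonZero c}} → ℚ.toℚᵘ (i ℚ./ c) ℚᵘ.≃ i ℚᵘ./ c
toℚᵘ-/ i (suc c) = ℚₚ.toℚᵘ-fromℚᵘ (mkℚᵘ i c)

module _ (c : ℕ) .{{_ : NonZero c}} where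

  quotient-step : ∀ g i j → i + g * c ≤ j → pos g ℚ./ 1 ℚ.≤ pos j ℚ./ c ℚ.- pos i ℚ./ c
  quotient-step g i j le = subst (ℚ._≤ pos j ℚ./ c ℚ.- pos i ℚ./ c) cancel
    (ℚₚ.+-monoˡ-≤ (ℚ.- (pos i ℚ./ c)) (ℚₚ.toℚᵘ-cancel-≤ (begin
      ℚ.toℚᵘ (pos g ℚ./ 1 ℚ.+ pos i ℚ./ c)             ≃⟨ ℚₚ.toℚᵘ-homo-+ (pos g ℚ./ 1) (pos i ℚ./ c) ⟩
      ℚ.toℚᵘ (pos g ℚ./ 1) ℚᵘ.+ ℚ.toℚᵘ (pos i ℚ./ c)   ≃⟨ ℚᵘₚ.+-cong (toℚᵘ-/ (pos g) 1) (toℚᵘ-/ (pos i) c) ⟩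
      pos g ℚᵘ./ 1 ℚᵘ.+ pos i ℚᵘ./ c                   ≤⟨ unnormalised c ⦃ it ⦄ le ⟩
      pos j ℚᵘ./ c                                   ≃⟨ toℚᵘ-/ (pos j) c ⟨
      ℚ.toℚᵘ (pos j ℚ./ c)                           ∎)))
    where
    open ℚᵘₚ.≤-Reasoning
    cancel : pos g ℚ./ 1 ℚ.+ pos i ℚ./ c ℚ.- pos i ℚ./ c ≡ pos g ℚ./ 1
    cancel = trans (ℚₚ.+-assoc (pos g ℚ./ 1) (pos i ℚ./ c) (ℚ.- (pos i ℚ./ c)))
      (trans (cong (pos g ℚ./ 1 ℚ.+_) (ℚₚ.+-inverseʳ (pos i ℚ./ c))) (ℚₚ.+-identityʳ (pos g ℚ./ 1)))
    unnormalised : ∀ c .{{_ : NonZero c}} → i + g * c ≤ j → pos g ℚᵘ./ 1 ℚᵘ.+ pos i ℚᵘ./ c ℚᵘ.≤ pos j ℚᵘ./ c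
    unnormalised c@(suc _) le = *≤* (subst₂ ℤ._≤_ (lhs c) (rhs c)
      (ℤ.+≤+ (*-monoˡ-≤ c le)))
      where
      lhs : ∀ c → pos ((i + g * c) * c) ≡ (pos g ℤ.* pos c ℤ.+ pos i ℤ.* pos 1) ℤ.* pos c
      lhs c = trans (ℤₚ.pos-* (i + g * c) c) (cong (ℤ._* pos c) (trans (cong pos (+-comm i (g * c)))
        (trans (ℤₚ.pos-+ (g * c) i) (cong₂ ℤ._+_ (ℤₚ.pos-* g c) (sym (ℤₚ.*-identityʳ (pos i)))))))
      rhs : ∀ c → pos (j * c) ≡ pos j ℤ.* pos (1 * c)
      rhs c = trans (ℤₚ.pos-* j c) (cong (λ t → pos j ℤ.* pos t) (sym (*-identityˡ c)))

  0/c : 0ℚ ≡ pos 0 ℚ./ c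
  0/c = ℚₚ.toℚᵘ-injective (ℚᵘₚ.≃-sym (ℚᵘₚ.≃-trans (toℚᵘ-/ (pos 0) c) (zero-≃ c)))
    where
    zero-≃ : ∀ c .{{_ : NonZero c}} → pos 0 ℚᵘ./ c ℚᵘ.≃ ℚ.toℚᵘ 0ℚ
    zero-≃ (suc c) = *≡* refl

  n/1 : ∀ a → pos a ℚ./ 1 ≡ pos (a * c) ℚ./ c
  n/1 a = ℚₚ.toℚᵘ-injective (ℚᵘₚ.≃-trans (toℚᵘ-/ (pos a) 1) (ℚᵘₚ.≃-sym (ℚᵘₚ.≃-trans (toℚᵘ-/ (pos (a * c)) c) (scale c))))
    where
    scale : ∀ c .{{_ : NonZero c}} → pos (a * c) ℚᵘ./ c ℚᵘ.≃ pos a ℚᵘ./ 1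
    scale (suc c) = *≡* (trans (ℤₚ.*-identityʳ (pos (a * suc c))) (ℤₚ.pos-* a (suc c)))

-- Abstract, because conversion checking would otherwise unfold the normalisation of rationals.
abstract

  frac : ∀ c .{{_ : NonZero c}} → ℕ → ℚ
  frac c i = pos i ℚ./ c

  frac-step : ∀ c .{{_ : NonZero c}} g i j → i + g * c ≤ j → frac 1 g ℚ.≤ frac c j ℚ.- frac c i
  frac-step c = quotient-step c

  frac-0 : ∀ c .{{_ : NonZero c}} → frac c 0 ≡ 0ℚ
  frac-0 c = sym (0/c c)

  frac-scale : ∀ c .{{_ : NonZero c}} a → frac c (a * c) ≡ pos a ℚ./ 1
  frac-scale c a = sym (n/1 c a)

  frac-1 : ∀ g → frac 1 g ≡ pos g ℚ./ 1
  frac-1 g = refl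

  frac-h : ∀ P x → frac (length (linearExtensions P)) {{linearExtensions-nonZero P}}
    (sum (map (λ f → suc (toℕ (f x))) (linearExtensions P))) ≡ h P x
  frac-h P x = refl

-- Linear extensions of two chains as lattice paths

injective⇒surjective : ∀ {n} {f : Fin n → Fin n} → Injective _≡_ _≡_ f → Surjective _≡_ _≡_ f
injective⇒surjective {n} {f} inj y with Finₚ.any? (λ x → f x Finₚ.≟ y)
... | yes (x , fx≡y) = x , λ { refl → fx≡y }
... | no  missed     = contradiction (Finₚ.injective⇒≤ g-injective) 1+n≰n
  where
  g : Fin (suc n) → Fin n
  g fzero    = y
  g (fsuc x) = f x
  g-injective : Injective _≡_ _≡_ g
  g-injective {fzero}  {fzero}   _  = refl
  g-injective {fzero}  {fsuc x}  eq = contradiction (x , sym eq) missed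
  g-injective {fsuc x} {fzero}   eq = contradiction (x , eq) missed
  g-injective {fsuc x} {fsuc x′} eq = cong fsuc (inj eq)

injective-bounded⇒≤ : ∀ {a b} (g : Fin a → ℕ) → Injective _≡_ _≡_ g → (∀ i → g i < b) → a ≤ b
injective-bounded⇒≤ g inj g<b = Finₚ.injective⇒≤ {f = λ i → fromℕ< (g<b i)}
  (λ {i} {j} eq → inj (Finₚ.fromℕ<-injective (g i) (g j) (g<b i) (g<b j) eq))

-- In other words g i - i is nondecreasing, written without subtraction. Applied to the places of
-- the a's, it makes the number of preceding b's nondecreasing.
increasing-gap : ∀ {n} (g : Fin n → ℕ) → (∀ {i j} → i Fin.< j → g i < g j) →
  ∀ i j → i Fin.≤ j → g i + toℕ j ≤ g j + toℕ i
increasing-gap g g-< fzero    fzero    _   = ≤-refl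
increasing-gap {suc (suc n)} g g-< fzero (fsuc j) _ = begin
  g fzero + suc (toℕ j)            ≡⟨ +-suc (g fzero) (toℕ j) ⟩
  suc (g fzero) + toℕ j            ≤⟨ +-monoˡ-≤ (toℕ j) (g-< {fzero} {fsuc fzero} z<s) ⟩
  g (fsuc fzero) + toℕ j           ≤⟨ increasing-gap (g ∘ fsuc) (g-< ∘ s<s) fzero j z≤n ⟩
  g (fsuc j) + 0                   ∎
  where open ≤-Reasoning
increasing-gap g g-< (fsuc i) (fsuc j) (s≤s i≤j) = subst₂ _≤_
  (sym (+-suc (g (fsuc i)) (toℕ j))) (sym (+-suc (g (fsuc j)) (toℕ i)))
  (s≤s (increasing-gap (g ∘ fsuc) (g-< ∘ s<s) i j i≤j))

module _ {A : Set} {φ ψ : A → ℕ} where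

  sum-mono : ∀ {xs} → All (λ x → φ x ≤ ψ x) xs → sum (map φ xs) ≤ sum (map ψ xs)
  sum-mono []         = z≤n
  sum-mono (le ∷ les) = +-mono-≤ le (sum-mono les)

  sum-+ : ∀ xs → sum (map (λ x → φ x + ψ x) xs) ≡ sum (map φ xs) + sum (map ψ xs)
  sum-+ []       = refl
  sum-+ (x ∷ xs) rewrite sum-+ xs = interchange +-commutativeSemigroup (φ x) (ψ x) _ _

allPairs-local : ∀ {A : Set} {P : A → Set} {R S : Rel A 0ℓ} →
  (∀ {x y} → P x → P y → R x y → S x y) → ∀ {xs} → All P xs → AllPairs R xs → AllPairs S xs
allPairs-local f []         []           = []
allPairs-local f (px ∷ pxs) (rx ∷ rxs) =
  All.zipWith (λ (py , r) → f px py r) (pxs , rx) ∷ allPairs-local f pxs rxs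

module TwoChains (n m : ℕ) (ρ : ℕ → ℕ)
  (ρ-mono : ∀ {i j} → i ≤ j → ρ i ≤ ρ j) (ρ≤m : ∀ {k} → k < n → ρ k ≤ m) where

  open Paths ρ

  Element : Set
  Element = Fin n ⊎ Fin m

  infix 4 _⊑_

  _⊑_ : Rel Element 0ℓ
  inj₁ i ⊑ inj₁ j = toℕ i ≤ toℕ j
  inj₁ i ⊑ inj₂ l = ρ (toℕ i) ≤ toℕ l
  inj₂ l ⊑ inj₁ i = ⊥
  inj₂ k ⊑ inj₂ l = toℕ k ≤ toℕ l

  ⊑-refl : ∀ u → u ⊑ u
  ⊑-refl (inj₁ i) = ≤-refl
  ⊑-refl (inj₂ l) = ≤-refl

  ⊑-trans : ∀ u v w → u ⊑ v → v ⊑ w → u ⊑ w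
  ⊑-trans (inj₁ _) (inj₁ _) (inj₁ _) p q = ≤-trans p q
  ⊑-trans (inj₁ _) (inj₁ _) (inj₂ _) p q = ≤-trans (ρ-mono p) q
  ⊑-trans (inj₁ _) (inj₂ _) (inj₂ _) p q = ≤-trans p q
  ⊑-trans (inj₂ _) (inj₂ _) (inj₂ _) p q = ≤-trans p q

  ⊑-antisym : ∀ u v → u ⊑ v → v ⊑ u → u ≡ v
  ⊑-antisym (inj₁ _) (inj₁ _) p q = cong inj₁ (Finₚ.toℕ-injective (≤-antisym p q))
  ⊑-antisym (inj₂ _) (inj₂ _) p q = cong inj₂ (Finₚ.toℕ-injective (≤-antisym p q))

  _⊑?_ : ∀ u v → Dec (u ⊑ v)
  inj₁ i ⊑? inj₁ j = toℕ i ≤? toℕ j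
  inj₁ i ⊑? inj₂ l = ρ (toℕ i) ≤? toℕ l
  inj₂ l ⊑? inj₁ i = no λ ()
  inj₂ k ⊑? inj₂ l = toℕ k ≤? toℕ l

  splitAt-injective : ∀ x y → splitAt n {m} x ≡ splitAt n y → x ≡ y
  splitAt-injective x y eq = trans (sym (Finₚ.join-splitAt n m x))
    (trans (cong (join n m) eq) (Finₚ.join-splitAt n m y))

  join-injective : ∀ {u v} → join n m u ≡ join n m v → u ≡ v
  join-injective {u} {v} eq = trans (sym (Finₚ.splitAt-join n m u))
    (trans (cong (splitAt n) eq) (Finₚ.splitAt-join n m v))

  P : FinitePoset
  P = record
    { size = n + m
    ; _≤_  = λ x y → splitAt n x ⊑ splitAt n y
    ; isDecPartialOrder = record
      { isPartialOrder = record
        { isPreorder = record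
          { isEquivalence = isEquivalence
          ; reflexive     = λ { {x} refl → ⊑-refl (splitAt n x) }
          ; trans         = λ {x} {y} {z} → ⊑-trans (splitAt n x) (splitAt n y) (splitAt n z)
          }
        ; antisym = λ {x} {y} p q → splitAt-injective x y (⊑-antisym (splitAt n x) (splitAt n y) p q)
        }
      ; _≟_  = Finₚ._≟_
      ; _≤?_ = λ x y → splitAt n x ⊑? splitAt n y
      }
    }

  module LinearExtension {f : Fin (n + m) → Fin (n + m)} (isLE : IsLinearExtension P f) where

    val : Element → ℕ
    val u = toℕ (f (join n m u))

    val-injective : ∀ {u v} → val u ≡ val v → u ≡ v
    val-injective eq = join-injective (proj₁ (proj₁ isLE) (Finₚ.toℕ-injective eq))

    val-surjective : ∀ {v} → v < n + m → ∃ λ u → val u ≡ v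
    val-surjective v<N with x , fx ← proj₂ (proj₁ isLE) (fromℕ< v<N) =
      splitAt n x , trans (cong toℕ (fx (Finₚ.join-splitAt n m x))) (Finₚ.toℕ-fromℕ< v<N)

    val-mono : ∀ {u v} → u ⊑ v → val u ≤ val v
    val-mono {u} {v} u⊑v = proj₂ isLE
      (subst₂ _⊑_ (sym (Finₚ.splitAt-join n m u)) (sym (Finₚ.splitAt-join n m v)) u⊑v)

    val-strict : ∀ {u v} → u ⊑ v → u ≢ v → val u < val v
    val-strict u⊑v u≢v = ≤∧≢⇒< (val-mono u⊑v) (u≢v ∘ val-injective)

    α : Fin n → ℕ
    α i = val (inj₁ i)

    β : Fin m → ℕ
    β l = val (inj₂ l)

    α-increasing : ∀ {i j} → i Fin.< j → α i < α j
    α-increasing i<j = val-strict (<⇒≤ i<j) (λ eq → Finₚ.<⇒≢ i<j (inj₁-injective eq))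

    β-increasing : ∀ {k l} → k Fin.< l → β k < β l
    β-increasing k<l = val-strict (<⇒≤ k<l) (λ eq → Finₚ.<⇒≢ k<l (inj₂-injective eq))

    α-gap : ∀ i j → i Fin.≤ j → α i + toℕ j ≤ α j + toℕ i
    α-gap = increasing-gap α α-increasing

    α-lower : ∀ i → toℕ i ≤ α i
    α-lower i@fzero    = z≤n
    α-lower i@(fsuc _) = ≤-trans (m≤n+m (toℕ i) (α fzero))
      (≤-trans (α-gap fzero i z≤n) (≤-reflexive (+-identityʳ (α i))))

    -- The elements preceding a_k are among a_0,…,a_{k-1} and b_0,…,b_{ρ(k)-1}.
    α-upper : ∀ k → α k ≤ toℕ k + ρ (toℕ k)
    α-upper k = injective-bounded⇒≤ (λ v → index (pre v)) index-injective (λ v → index-bound (pre v) (pre-below v))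
      where
      pre : Fin (α k) → Element
      pre v = proj₁ (val-surjective (<-trans (Finₚ.toℕ<n v) (Finₚ.toℕ<n (f (k ↑ˡ m)))))
      val-pre : ∀ v → val (pre v) ≡ toℕ v
      val-pre v = proj₂ (val-surjective (<-trans (Finₚ.toℕ<n v) (Finₚ.toℕ<n (f (k ↑ˡ m)))))
      pre-below : ∀ v → val (pre v) < α k
      pre-below v = subst (_< α k) (sym (val-pre v)) (Finₚ.toℕ<n v)
      index : Element → ℕ
      index (inj₁ i) = toℕ i
      index (inj₂ l) = toℕ k + toℕ l
      i<k : ∀ i → α i < α k → toℕ i < toℕ k
      i<k i lt = ≰⇒> (λ k≤i → <⇒≱ lt (val-mono {inj₁ k} {inj₁ i} k≤i))
      index-bound : ∀ u → val u < α k → index u < toℕ k + ρ (toℕ k)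
      index-bound (inj₁ i) lt = ≤-trans (i<k i lt) (m≤m+n _ _)
      index-bound (inj₂ l) lt = +-monoʳ-< (toℕ k) (≰⇒> (λ ρ≤l → <⇒≱ lt (val-mono {inj₁ k} {inj₂ l} ρ≤l)))
      index-cancel : ∀ u u′ → val u < α k → val u′ < α k → index u ≡ index u′ → u ≡ u′
      index-cancel (inj₁ i) (inj₁ j) _  _  eq = cong inj₁ (Finₚ.toℕ-injective eq)
      index-cancel (inj₁ i) (inj₂ l) lt _  eq = contradiction (i<k i lt) (≤⇒≯ (≤-trans (m≤m+n _ _) (≤-reflexive (sym eq))))
      index-cancel (inj₂ l) (inj₁ i) _  lt eq = contradiction (i<k i lt) (≤⇒≯ (≤-trans (m≤m+n _ _) (≤-reflexive eq)))
      index-cancel (inj₂ l) (inj₂ l′) _ _  eq = cong inj₂ (Finₚ.toℕ-injective (+-cancelˡ-≡ (toℕ k) _ _ eq))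
      index-injective : Injective _≡_ _≡_ (λ v → index (pre v))
      index-injective {v} {v′} eq = Finₚ.toℕ-injective (trans (sym (val-pre v))
        (trans (cong val (index-cancel (pre v) (pre v′) (pre-below v) (pre-below v′) eq)) (val-pre v′)))

    -- The first c a's and the l earlier b's all precede b_l, and their values are distinct.
    β-lower : ∀ {c} l → c ≤ n → (∀ {i} → i < c → ρ i ≤ toℕ l) → c + toℕ l ≤ β l
    β-lower {c} l c≤n ρ≤l = injective-bounded⇒≤ (λ s → val (below (splitAt c s)))
      (λ {s} {s′} eq → trans (sym (Finₚ.join-splitAt c (toℕ l) s))
        (trans (cong (join c (toℕ l)) (below-injective (splitAt c s) (splitAt c s′) (val-injective eq)))
          (Finₚ.join-splitAt c (toℕ l) s′)))
      (λ s → below-< (splitAt c s))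
      where
      l≤m : toℕ l ≤ m
      l≤m = <⇒≤ (Finₚ.toℕ<n l)
      below : Fin c ⊎ Fin (toℕ l) → Element
      below (inj₁ i) = inj₁ (inject≤ i c≤n)
      below (inj₂ j) = inj₂ (inject≤ j l≤m)
      below-< : ∀ s → val (below s) < β l
      below-< (inj₁ i) = val-strict {inj₁ (inject≤ i c≤n)} {inj₂ l}
        (subst (λ t → ρ t ≤ toℕ l) (sym (Finₚ.toℕ-inject≤ i c≤n)) (ρ≤l (Finₚ.toℕ<n i))) (λ ())
      below-< (inj₂ j) = β-increasing (subst (_< toℕ l) (sym (Finₚ.toℕ-inject≤ j l≤m)) (Finₚ.toℕ<n j))
      below-injective : ∀ s s′ → below s ≡ below s′ → s ≡ s′
      below-injective (inj₁ i) (inj₁ j) eq = cong inj₁ (Finₚ.inject≤-injective c≤n c≤n i j (inj₁-injective eq))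
      below-injective (inj₂ i) (inj₂ j) eq = cong inj₂ (Finₚ.inject≤-injective l≤m l≤m i j (inj₂-injective eq))

  -- The number of b's preceding each a.
  profile : (Fin (n + m) → Fin (n + m)) → Vec ℕ n
  profile f = tabulate (λ i → toℕ (f (i ↑ˡ m)) ∸ toℕ i)

  isPath-tabulate : ∀ {k} (g : Fin k → ℕ) {c lo} → (∀ i → lo ≤ g i) →
    (∀ {i j} → i Fin.≤ j → g i ≤ g j) → (∀ i → g i ≤ ρ (c + toℕ i)) → IsPath c lo (tabulate g)
  isPath-tabulate {zero}  g lo≤ mono ≤ρ = []
  isPath-tabulate {suc k} g {c} lo≤ mono ≤ρ =
    (lo≤ fzero , subst (λ t → g fzero ≤ ρ t) (+-identityʳ c) (≤ρ fzero))
    ∷ isPath-tabulate (g ∘ fsuc) (λ i → mono {fzero} {fsuc i} z≤n) (mono ∘ s≤s)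
        (λ i → subst (λ t → g (fsuc i) ≤ ρ t) (+-suc c (toℕ i)) (≤ρ (fsuc i)))

  module _ {f} (isLE : IsLinearExtension P f) where
    open LinearExtension isLE

    profile-isPath : IsPath 0 0 (profile f)
    profile-isPath = isPath-tabulate _ (λ _ → z≤n)
      (λ {i} {j} i≤j → m≤n+o⇒m∸n≤o (α i) (toℕ i) (+-cancelʳ-≤ (toℕ j) _ _ (begin
        α i + toℕ j                          ≤⟨ α-gap i j i≤j ⟩
        α j + toℕ i                          ≡⟨ cong (_+ toℕ i) (m∸n+n≡m (α-lower j)) ⟨
        α j ∸ toℕ j + toℕ j + toℕ i          ≡⟨ +-comm _ (toℕ i) ⟩
        toℕ i + (α j ∸ toℕ j + toℕ j)        ≡⟨ +-assoc (toℕ i) _ (toℕ j) ⟨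
        toℕ i + (α j ∸ toℕ j) + toℕ j        ∎)))
      (λ i → m≤n+o⇒m∸n≤o (α i) (toℕ i) (α-upper i))
      where open ≤-Reasoning

    α-profile : ∀ i → α i ≡ toℕ i + lookup (profile f) i
    α-profile i = trans (sym (m+[n∸m]≡n (α-lower i)))
      (cong (toℕ i +_) (sym (lookup∘tabulate (λ i → α i ∸ toℕ i) i)))

  -- Look at what `g` puts in the place f(b_l). An a there would have the same place under `f`,
  -- against injectivity. A b there comes before b_l under `g`, so it has a smaller index and again
  -- the same place under `f`.
  β-not-earlier : ∀ {f g} (f-LE : IsLinearExtension P f) (g-LE : IsLinearExtension P g) →
    let open LinearExtension in
    (∀ i → α f-LE i ≡ α g-LE i) → ∀ l → (∀ k → k Fin.< l → β f-LE k ≡ β g-LE k) →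
    ¬ (β f-LE l < β g-LE l)
  β-not-earlier {f} f-LE g-LE same-α l same-β βf<βg
    with LinearExtension.val-surjective g-LE (Finₚ.toℕ<n (f (n ↑ʳ l)))
  ... | inj₁ i , eq = contradiction
    (LinearExtension.val-injective f-LE {inj₁ i} {inj₂ l} (trans (same-α i) eq)) (λ ())
  ... | inj₂ k , eq = <-irrefl (cong toℕ k≡l) k<l
    where
    k<l : k Fin.< l
    k<l = ≰⇒> (λ l≤k → <⇒≱ βf<βg
      (≤-trans (LinearExtension.val-mono g-LE {inj₂ l} {inj₂ k} l≤k) (≤-reflexive eq)))
    k≡l : k ≡ l
    k≡l = inj₂-injective (LinearExtension.val-injective f-LE (trans (same-β k k<l) eq))

  -- The b's fill, in order, the places left free by the a's.
  profile-injective : ∀ {f g} → IsLinearExtension P f → IsLinearExtension P g →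
    profile f ≡ profile g → f ≗ g
  profile-injective {f} {g} f-LE g-LE eq x = Finₚ.toℕ-injective (trans
    (cong (toℕ ∘ f) (sym (Finₚ.join-splitAt n m x)))
    (trans (vals (splitAt n x)) (cong (toℕ ∘ g) (Finₚ.join-splitAt n m x))))
    where
    module f = LinearExtension f-LE
    module g = LinearExtension g-LE
    αs : ∀ i → f.α i ≡ g.α i
    αs i = trans (α-profile f-LE i) (trans (cong (λ xs → toℕ i + lookup xs i) eq) (sym (α-profile g-LE i)))

    βs-below : ∀ t l → toℕ l < t → f.β l ≡ g.β l
    βs-below (suc t) l (s≤s l≤t) with <-cmp (f.β l) (g.β l)
    ... | tri≈ _ e _  = e
    ... | tri< lt _ _ = contradiction lt (β-not-earlier f-LE g-LE αs l (λ k k<l → βs-below t k (<-≤-trans k<l l≤t)))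
    ... | tri> _ _ gt = contradiction gt (β-not-earlier g-LE f-LE (sym ∘ αs) l (λ k k<l → sym (βs-below t k (<-≤-trans k<l l≤t))))

    vals : ∀ u → f.val u ≡ g.val u
    vals (inj₁ i) = αs i
    vals (inj₂ l) = βs-below (suc (toℕ l)) l ≤-refl

  -- The count stops at the first term exceeding l, so it is meant for nondecreasing sequences.
  countUpTo : ∀ {k} → ℕ → Vec ℕ k → ℕ
  countUpTo l []       = 0
  countUpTo l (x ∷ xs) with x ≤? l
  ... | yes _ = suc (countUpTo l xs)
  ... | no  _ = 0

  countUpTo-≤ : ∀ {k} l (xs : Vec ℕ k) → countUpTo l xs ≤ k
  countUpTo-≤ l []       = z≤n
  countUpTo-≤ l (x ∷ xs) with x ≤? l
  ... | yes _ = s≤s (countUpTo-≤ l xs)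
  ... | no  _ = z≤n

  countUpTo-mono : ∀ {k l l′} (xs : Vec ℕ k) → l ≤ l′ → countUpTo l xs ≤ countUpTo l′ xs
  countUpTo-mono []       l≤l′ = z≤n
  countUpTo-mono {l = l} {l′} (x ∷ xs) l≤l′ with x ≤? l | x ≤? l′
  ... | yes _   | yes _    = s≤s (countUpTo-mono xs l≤l′)
  ... | yes x≤l | no  x≰l′ = contradiction (≤-trans x≤l l≤l′) x≰l′
  ... | no  _   | _        = z≤n

  lookup-lower : ∀ {k c lo} {xs : Vec ℕ k} → IsPath c lo xs → ∀ i → lo ≤ lookup xs i
  lookup-lower ((lo≤x , _) ∷ path) fzero    = lo≤x
  lookup-lower ((lo≤x , _) ∷ path) (fsuc i) = ≤-trans lo≤x (lookup-lower path i)

  lookup-upper : ∀ {k c lo} {xs : Vec ℕ k} → IsPath c lo xs → ∀ i → lookup xs i ≤ ρ (c + toℕ i)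
  lookup-upper {c = c} (_∷_ {x = x} (_ , x≤ρ) path) fzero    = subst (λ t → x ≤ ρ t) (sym (+-identityʳ c)) x≤ρ
  lookup-upper {c = c} {xs = _ ∷ xs} (_ ∷ path)          (fsuc i) = subst (λ t → lookup xs i ≤ ρ t) (sym (+-suc c (toℕ i))) (lookup-upper path i)

  lookup-mono : ∀ {k c lo} {xs : Vec ℕ k} → IsPath c lo xs → ∀ {i j} → i Fin.≤ j → lookup xs i ≤ lookup xs j
  lookup-mono (_ ∷ path) {fzero}  {fzero}  _         = ≤-refl
  lookup-mono (_ ∷ path) {fzero}  {fsuc j} _         = lookup-lower path j
  lookup-mono (_ ∷ path) {fsuc i} {fsuc j} (s≤s i≤j) = lookup-mono path i≤j

  lookup≤⇒<countUpTo : ∀ {k c lo l} {xs : Vec ℕ k} → IsPath c lo xs →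
    ∀ i → lookup xs i ≤ l → toℕ i < countUpTo l xs
  lookup≤⇒<countUpTo {l = l} {xs = x ∷ xs} (_ ∷ path) i le with x ≤? l
  lookup≤⇒<countUpTo (_ ∷ path) fzero    le | yes _   = z<s
  lookup≤⇒<countUpTo (_ ∷ path) (fsuc i) le | yes _   = s≤s (lookup≤⇒<countUpTo path i le)
  lookup≤⇒<countUpTo (_ ∷ path) fzero    le | no  x≰l = contradiction le x≰l
  lookup≤⇒<countUpTo (_ ∷ path) (fsuc i) le | no  x≰l = contradiction (≤-trans (lookup-lower path i) le) x≰l

  lookup>⇒≥countUpTo : ∀ {k l} (xs : Vec ℕ k) i → l < lookup xs i → countUpTo l xs ≤ toℕ i
  lookup>⇒≥countUpTo {l = l} (x ∷ xs) i gt with x ≤? l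
  lookup>⇒≥countUpTo (x ∷ xs) fzero    gt | yes x≤l = contradiction x≤l (<⇒≱ gt)
  lookup>⇒≥countUpTo (x ∷ xs) (fsuc i) gt | yes _   = s≤s (lookup>⇒≥countUpTo xs i gt)
  lookup>⇒≥countUpTo (x ∷ xs) i        gt | no  _   = z≤n

  module FromPath {xs : Vec ℕ n} (path : IsPath 0 0 xs) where

    -- The inverse of `profile`: a_i follows i a's and x_i b's, while b_l follows l b's and the a's
    -- with x_i ≤ l.
    place : Element → ℕ
    place (inj₁ i) = toℕ i + lookup xs i
    place (inj₂ l) = toℕ l + countUpTo (toℕ l) xs

    place< : ∀ u → place u < n + m
    place< (inj₁ i) = +-mono-<-≤ (Finₚ.toℕ<n i) (≤-trans (lookup-upper path i) (ρ≤m (Finₚ.toℕ<n i)))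
    place< (inj₂ l) = subst (place (inj₂ l) <_) (+-comm m n) (+-mono-<-≤ (Finₚ.toℕ<n l) (countUpTo-≤ (toℕ l) xs))

    before : ∀ i l → lookup xs i ≤ toℕ l → place (inj₁ i) < place (inj₂ l)
    before i l le = subst (place (inj₁ i) <_) (+-comm (countUpTo (toℕ l) xs) (toℕ l))
      (+-mono-<-≤ (lookup≤⇒<countUpTo path i le) le)

    after : ∀ i l → toℕ l < lookup xs i → place (inj₂ l) < place (inj₁ i)
    after i l gt = subst (place (inj₂ l) <_) (+-comm (lookup xs i) (toℕ i))
      (+-mono-<-≤ gt (lookup>⇒≥countUpTo xs i gt))

    separate : ∀ i l → place (inj₁ i) ≢ place (inj₂ l)
    separate i l eq with lookup xs i ≤? toℕ l
    ... | yes le = <⇒≢ (before i l le) eq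
    ... | no ¬le = <⇒≢ (after i l (≰⇒> ¬le)) (sym eq)

    place-mono : ∀ u v → u ⊑ v → place u ≤ place v
    place-mono (inj₁ i) (inj₁ j) i≤j = +-mono-≤ i≤j (lookup-mono path i≤j)
    place-mono (inj₁ i) (inj₂ l) ρ≤l = <⇒≤ (before i l (≤-trans (lookup-upper path i) ρ≤l))
    place-mono (inj₂ k) (inj₂ l) k≤l = +-mono-≤ k≤l (countUpTo-mono xs k≤l)

    place-injective : ∀ u v → place u ≡ place v → u ≡ v
    place-injective (inj₁ i) (inj₂ l) eq = contradiction eq (separate i l)
    place-injective (inj₂ l) (inj₁ i) eq = contradiction (sym eq) (separate i l)
    place-injective (inj₁ i) (inj₁ j) eq with Finₚ.<-cmp i j
    ... | tri≈ _ e _  = cong inj₁ e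
    ... | tri< lt _ _ = contradiction eq (<⇒≢ (+-mono-<-≤ lt (lookup-mono path (<⇒≤ lt))))
    ... | tri> _ _ gt = contradiction (sym eq) (<⇒≢ (+-mono-<-≤ gt (lookup-mono path (<⇒≤ gt))))
    place-injective (inj₂ k) (inj₂ l) eq with Finₚ.<-cmp k l
    ... | tri≈ _ e _  = cong inj₂ e
    ... | tri< lt _ _ = contradiction eq (<⇒≢ (+-mono-<-≤ lt (countUpTo-mono xs (<⇒≤ lt))))
    ... | tri> _ _ gt = contradiction (sym eq) (<⇒≢ (+-mono-<-≤ gt (countUpTo-mono xs (<⇒≤ gt))))

    extension : Fin (n + m) → Fin (n + m)
    extension x = fromℕ< (place< (splitAt n x))

    -- The enumeration of functions contains `extension` only up to pointwise equality, so its
    -- properties are proved for every pointwise equal function.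
    module _ {f : Fin (n + m) → Fin (n + m)} (f≗ : f ≗ extension) where

      toℕ-f : ∀ x → toℕ (f x) ≡ place (splitAt n x)
      toℕ-f x = trans (cong toℕ (f≗ x)) (Finₚ.toℕ-fromℕ< (place< (splitAt n x)))

      isLinearExtension : IsLinearExtension P f
      isLinearExtension = (inj , injective⇒surjective inj) , λ {x} {y} x≤y →
        subst₂ _≤_ (sym (toℕ-f x)) (sym (toℕ-f y)) (place-mono (splitAt n x) (splitAt n y) x≤y)
        where
        inj : Injective _≡_ _≡_ f
        inj {x} {y} eq = splitAt-injective x y (place-injective (splitAt n x) (splitAt n y)
          (trans (sym (toℕ-f x)) (trans (cong toℕ eq) (toℕ-f y))))

      profile≡ : profile f ≡ xs
      profile≡ = trans (tabulate-cong (λ i → trans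
        (cong (_∸ toℕ i) (trans (toℕ-f (i ↑ˡ m)) (cong place (Finₚ.splitAt-↑ˡ n i m))))
        (m+n∸m≡n (toℕ i) (lookup xs i)))) (tabulate∘lookup xs)

  extensions : List (Fin (n + m) → Fin (n + m))
  extensions = linearExtensions P

  all-LE : All (IsLinearExtension P) extensions
  all-LE = all-filter (isLinearExtension? P) (map finToFun (allFin ((n + m) ^ (n + m))))

  -- Distinct codes give pointwise different functions, and pointwise difference is what
  -- `profile-injective` turns into different profiles.
  profiles-unique : Unique (map profile extensions)
  profiles-unique = AllPairsₚ.map⁺ (allPairs-local {R = λ f g → ¬ (f ≗ g)}
    (λ {f} {g} f-LE g-LE f≢g eq → f≢g (profile-injective f-LE g-LE eq)) all-LE
    (AllPairsₚ.filter⁺ (isLinearExtension? P) (AllPairsₚ.map⁺ (AllPairs.map distinct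
      (Unique.allFin⁺ ((n + m) ^ (n + m)))))))
    where
    distinct : ∀ {i j : Fin ((n + m) ^ (n + m))} → i ≢ j → ¬ (finToFun i ≗ finToFun {n + m} {n + m} j)
    distinct {i} {j} i≢j eq = i≢j (trans (sym (Finₚ.funToFin-finToFin {n + m} {n + m} i))
      (trans (funToFin-cong eq) (Finₚ.funToFin-finToFin {n + m} {n + m} j)))
      where
      funToFin-cong : ∀ {a b} {f g : Fin a → Fin b} → f ≗ g → funToFin f ≡ funToFin g
      funToFin-cong {zero}  eq = refl
      funToFin-cong {suc a} eq = cong₂ Fin.combine (eq fzero) (funToFin-cong (eq ∘ fsuc))

  -- Both lists are free of repetitions and have the same members. Sums over linear extensions
  -- thereby become sums over paths.
  profiles↭paths : map profile extensions ↭ paths n 0 0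
  profiles↭paths = ∼bag⇒↭ (unique∧set⇒bag profiles-unique (paths-unique n 0 0) (mk⇔ to from))
    where
    to : ∀ {xs} → xs ∈ map profile extensions → xs ∈ paths n 0 0
    to xs∈ with f , f∈ , refl ← ∈-map⁻ profile xs∈ = ∈-paths⁺ (profile-isPath (All.lookup all-LE f∈))
    from : ∀ {xs} → xs ∈ paths n 0 0 → xs ∈ map profile extensions
    from {xs} xs∈ = subst (_∈ map profile extensions) (profile≡ same)
      (∈-map⁺ profile (∈-filter⁺ (isLinearExtension? P)
        (∈-map⁺ finToFun (∈-allFin (funToFin extension))) (isLinearExtension same)))
      where
      open FromPath (∈-paths⁻ xs∈)
      same : finToFun (funToFin extension) ≗ extension
      same = Finₚ.finToFun-funToFin extension

  abstract

    count : ℕ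
    count = length extensions

    -- The average height multiplied by `count`, so that heights can be compared in ℕ.
    totalHeight : Fin (n + m) → ℕ
    totalHeight x = sum (map (λ f → suc (toℕ (f x))) extensions)

    instance
      count-nonZero : NonZero count
      count-nonZero = linearExtensions-nonZero P

    frac-totalHeight : ∀ x → frac count (totalHeight x) ≡ h P x
    frac-totalHeight x = frac-h P x

    count≡ : count ≡ length (paths n 0 0)
    count≡ = trans (sym (length-map profile extensions)) (↭-length profiles↭paths)

    totalHeight-a : ∀ k → totalHeight (k ↑ˡ m) ≡ count * suc (toℕ k) + sum (map (λ xs → lookup xs k) (paths n 0 0))
    totalHeight-a k = begin
      totalHeight (k ↑ˡ m)
        ≡⟨ cong sum (map-cong-local (All.map (λ f-LE → cong suc (α-profile f-LE k)) all-LE)) ⟩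
      sum (map (λ f → suc (toℕ k) + lookup (profile f) k) extensions)
        ≡⟨ sum-+ extensions ⟩
      sum (map (λ _ → suc (toℕ k)) extensions) + sum (map (λ f → lookup (profile f) k) extensions)
        ≡⟨ cong₂ _+_ (sum-const (suc (toℕ k)) extensions) (cong sum (map-∘ extensions)) ⟩
      count * suc (toℕ k) + sum (map (λ xs → lookup xs k) (map profile extensions))
        ≡⟨ cong (count * suc (toℕ k) +_) (sum-↭ (↭-map⁺ (λ xs → lookup xs k) profiles↭paths)) ⟩
      count * suc (toℕ k) + sum (map (λ xs → lookup xs k) (paths n 0 0)) ∎
      where open ≡-Reasoning

    totalHeight-mono : ∀ u v → u ⊑ v → totalHeight (join n m u) ≤ totalHeight (join n m v)
    totalHeight-mono u v u⊑v = sum-mono (All.map (λ f-LE → s≤s (LinearExtension.val-mono f-LE u⊑v)) all-LE)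

    totalHeight-a-upper : ∀ k → totalHeight (k ↑ˡ m) ≤ count * suc (toℕ k + ρ (toℕ k))
    totalHeight-a-upper k = ≤-trans (sum-mono (All.map (λ f-LE → s≤s (LinearExtension.α-upper f-LE k)) all-LE))
      (≤-reflexive (sum-const _ extensions))

    totalHeight-b-lower : ∀ {c} l → c ≤ n → (∀ {i} → i < c → ρ i ≤ toℕ l) →
      count * suc (c + toℕ l) ≤ totalHeight (n ↑ʳ l)
    totalHeight-b-lower l c≤n ρ≤l = ≤-trans (≤-reflexive (sym (sum-const _ extensions)))
      (sum-mono (All.map (λ f-LE → s≤s (LinearExtension.β-lower f-LE l c≤n ρ≤l)) all-LE))

-- Width two, and a criterion for large chain gaps

∣++∣ : ∀ {a b} (p : Subset a) (q : Subset b) → ∣ p ++ q ∣ ≡ ∣ p ∣ + ∣ q ∣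
∣++∣ []            q = refl
∣++∣ (inside  ∷ p) q = cong suc (∣++∣ p q)
∣++∣ (outside ∷ p) q = ∣++∣ p q

subsingleton⇒∣∣≤1 : ∀ {a} (p : Subset a) → (∀ {x y} → x ∈ₛ p → y ∈ₛ p → x ≡ y) → ∣ p ∣ ≤ 1
subsingleton⇒∣∣≤1 []            _    = z≤n
subsingleton⇒∣∣≤1 (outside ∷ p) same =
  subsingleton⇒∣∣≤1 p (λ x∈ y∈ → Finₚ.suc-injective (same (there x∈) (there y∈)))
subsingleton⇒∣∣≤1 {suc a} (inside ∷ p) same = s≤s (≤-reflexive (trans (cong ∣_∣ (Empty-unique empty)) (∣⊥∣≡0 a)))
  where
  empty : Empty p
  empty (x , x∈) with () ← same here (there x∈)

module Criterion (n m : ℕ) (ρ : ℕ → ℕ)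
  (ρ-mono : ∀ {i j} → i ≤ j → ρ i ≤ ρ j) (ρ≤m : ∀ {k} → k < n → ρ k ≤ m) where

  open TwoChains n m ρ ρ-mono ρ≤m

  width-two : (i : Fin n) (l : Fin m) → toℕ l < ρ (toℕ i) → HasWidth P 2
  width-two i l l<ρ = (⁅ i ⁆ ++ ⁅ l ⁆ , antichain , size-two) , at-most-two
    where
    size-two : ∣ ⁅ i ⁆ ++ ⁅ l ⁆ ∣ ≡ 2
    size-two = trans (∣++∣ ⁅ i ⁆ ⁅ l ⁆) (cong₂ _+_ (∣⁅x⁆∣≡1 i) (∣⁅x⁆∣≡1 l))

    IsEither : Element → Set
    IsEither u = u ≡ inj₁ i ⊎ u ≡ inj₂ l

    isEither : ∀ {x} → x ∈ₛ ⁅ i ⁆ ++ ⁅ l ⁆ → IsEither (splitAt n x)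
    isEither {x} x∈ with splitAt n x | trans (sym (lookup-splitAt n ⁅ i ⁆ ⁅ l ⁆ x)) ([]=⇒lookup x∈)
    ... | inj₁ j | eq = inj₁ (cong inj₁ (x∈⁅y⁆⇒x≡y i (lookup⇒[]= j ⁅ i ⁆ eq)))
    ... | inj₂ k | eq = inj₂ (cong inj₂ (x∈⁅y⁆⇒x≡y l (lookup⇒[]= k ⁅ l ⁆ eq)))

    incomparable : ∀ {u v} → IsEither u → IsEither v → u ≢ v → ¬ (u ⊑ v) × ¬ (v ⊑ u)
    incomparable (inj₁ refl) (inj₁ refl) u≢v = contradiction refl u≢v
    incomparable (inj₁ refl) (inj₂ refl) u≢v = <⇒≱ l<ρ , λ ()
    incomparable (inj₂ refl) (inj₁ refl) u≢v = (λ ()) , <⇒≱ l<ρ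
    incomparable (inj₂ refl) (inj₂ refl) u≢v = contradiction refl u≢v

    antichain : IsAntichain P (⁅ i ⁆ ++ ⁅ l ⁆)
    antichain {x} {y} x∈ y∈ x≢y =
      incomparable (isEither x∈) (isEither y∈) (λ eq → x≢y (splitAt-injective x y eq))

    at-most-two : ∀ A → IsAntichain P A → ∣ A ∣ ≤ 2
    at-most-two A anti with p , q , refl ← Vec.splitAt n A = begin
      ∣ p ++ q ∣      ≡⟨ ∣++∣ p q ⟩
      ∣ p ∣ + ∣ q ∣   ≤⟨ +-mono-≤ (subsingleton⇒∣∣≤1 p as) (subsingleton⇒∣∣≤1 q bs) ⟩
      2               ∎
      where
      open ≤-Reasoning
      equal : ∀ u v → u ⊑ v ⊎ v ⊑ u → join n m u ∈ₛ p ++ q → join n m v ∈ₛ p ++ q → u ≡ v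
      equal u v comparable u∈ v∈ with join n m u Finₚ.≟ join n m v | comparable
      ... | yes eq | _        = join-injective eq
      ... | no neq | inj₁ u⊑v = contradiction (subst₂ _⊑_ (sym (Finₚ.splitAt-join n m u)) (sym (Finₚ.splitAt-join n m v)) u⊑v) (proj₁ (anti u∈ v∈ neq))
      ... | no neq | inj₂ v⊑u = contradiction (subst₂ _⊑_ (sym (Finₚ.splitAt-join n m v)) (sym (Finₚ.splitAt-join n m u)) v⊑u) (proj₂ (anti u∈ v∈ neq))
      as : ∀ {x y} → x ∈ₛ p → y ∈ₛ p → x ≡ y
      as {x} {y} x∈ y∈ with refl ← equal (inj₁ x) (inj₁ y) (≤-total (toℕ x) (toℕ y))
        (lookup⇒[]= _ _ (trans (lookup-++ˡ p q x) ([]=⇒lookup x∈)))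
        (lookup⇒[]= _ _ (trans (lookup-++ˡ p q y) ([]=⇒lookup y∈))) = refl
      bs : ∀ {x y} → x ∈ₛ q → y ∈ₛ q → x ≡ y
      bs {x} {y} x∈ y∈ with refl ← equal (inj₂ x) (inj₂ y) (≤-total (toℕ x) (toℕ y))
        (lookup⇒[]= _ _ (trans (lookup-++ʳ p q x) ([]=⇒lookup x∈)))
        (lookup⇒[]= _ _ (trans (lookup-++ʳ p q y) ([]=⇒lookup y∈))) = refl

  -- `φ` is known only through `φ-step`: the search for a large step takes place in ℕ, and rationals
  -- enter when the step is found.
  module ChainGap
    (total : Element → ℕ) (γ top : ℕ) (φ : ℕ → ℚ) (g : ℚ)
    (φ-step : ∀ i j → i + γ ≤ j → g ℚ.≤ φ j ℚ.- φ i) where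

    HasStep : ℕ → List Element → Set
    HasStep a us = g ℚ.≤ largestStep (φ a) (map (φ ∘ total) us) (φ top)

    step-end : ∀ {a} → a + γ ≤ top → HasStep a []
    step-end {a} = φ-step a top

    step-here : ∀ {a u us} → a + γ ≤ total u → HasStep a (u ∷ us)
    step-here {a} {u} le = ℚₚ.≤-trans (φ-step a (total u) le) (ℚₚ.p≤p⊔q _ _)

    step-there : ∀ {a u us} → HasStep (total u) us → HasStep a (u ∷ us)
    step-there {a} {u} st = ℚₚ.≤-trans st (ℚₚ.p≤q⊔p (φ (total u) ℚ.- φ a) _)

    _⊏_ : Element → Element → Set
    u ⊏ v = u ⊑ v × u ≢ v

    -- A pigeonhole at each end: only r b's precede b_r, but r + 1 steps of size `γ` fit below `B`;
    -- at most s₀ a's have index k₀ or more, but s₀ + 1 steps fit between `U` and `top`.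
    module _ (r B s₀ k₀ U : ℕ)
      (b-budget : suc r * γ ≤ B)
      (b-high   : ∀ l → r ≤ toℕ l → B ≤ total (inj₂ l))
      (B≤top    : B ≤ top)
      (a-budget : U + suc s₀ * γ ≤ top)
      (a-low    : ∀ k → toℕ k < k₀ → total (inj₁ k) ≤ U)
      (n≤       : n ≤ k₀ + s₀)
      (switch   : ∀ k l → inj₁ k ⊑ inj₂ l → total (inj₁ k) + γ ≤ total (inj₂ l))
      where

      open ≤-Reasoning

      advance : ∀ {a h t s} → h < a + γ → a + suc (suc s) * γ ≤ t → h + suc s * γ ≤ t
      advance {a} {h} {t} {s} h< le = begin
        h + suc s * γ           ≤⟨ +-monoˡ-≤ (suc s * γ) (<⇒≤ h<) ⟩
        a + γ + suc s * γ       ≡⟨ +-assoc a γ (suc s * γ) ⟩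
        a + suc (suc s) * γ     ≤⟨ le ⟩
        t                       ∎

      spend : ∀ {a t} s → a + suc s * γ ≤ t → a + γ ≤ t
      spend {a} s le = ≤-trans (+-monoʳ-≤ a (m≤m+n γ (s * γ))) le

      -- s bounds the number of elements of the chain that may still come below b_r.
      b-chain : ∀ a s l us → r ≤ toℕ l + s → a + suc s * γ ≤ B →
        Linked _⊏_ (inj₂ l ∷ us) → HasStep a (inj₂ l ∷ us)
      b-chain a s l us r≤ budget chain with r ≤? toℕ l
      ... | yes r≤l = step-here {a} {inj₂ l} {us} (≤-trans (spend s budget) (b-high l r≤l))
      b-chain a zero l us r≤ budget chain | no r≰l =
        contradiction (≤-trans r≤ (≤-reflexive (+-identityʳ _))) r≰l
      b-chain a (suc s) l us r≤ budget chain | no r≰l with a + γ ≤? total (inj₂ l)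
      ... | yes le = step-here {a} {inj₂ l} {us} le
      b-chain a (suc s) l [] r≤ budget chain | no r≰l | no nle =
        step-there {a} {inj₂ l} {[]} (step-end {total (inj₂ l)} (≤-trans (spend s (advance {a} {total (inj₂ l)} {B} {s} (≰⇒> nle) budget)) B≤top))
      b-chain a (suc s) l (inj₂ l′ ∷ us) r≤ budget ((l≤l′ , l≢l′) ∷ chain) | no r≰l | no nle =
        step-there {a} {inj₂ l} {inj₂ l′ ∷ us} (b-chain (total (inj₂ l)) s l′ us
          (≤-trans r≤ (≤-trans (≤-reflexive (+-suc (toℕ l) s)) (+-monoˡ-≤ s (≤∧≢⇒< l≤l′ (λ eq → l≢l′ (cong inj₂ (Finₚ.toℕ-injective eq)))))))
          (advance {a} {total (inj₂ l)} {B} {s} (≰⇒> nle) budget) chain)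

      -- A run of a's ends at `top` or at a b, where `switch` gives the step. Elements before index
      -- `k₀` are passed over, and each resets the budget to the s₀ + 1 steps above `U`; from `k₀`
      -- on, s bounds the number of a's left, and every short step uses up one.
      a-chain : ∀ a s k us → (k₀ ≤ toℕ k → n ≤ toℕ k + s) → a + suc s * γ ≤ top →
        Linked _⊏_ (inj₁ k ∷ us) → HasStep a (inj₁ k ∷ us)

      a-next : ∀ s k us → (∀ {j} → toℕ k < j → k₀ ≤ j → n ≤ j + s) → total (inj₁ k) + suc s * γ ≤ top →
        Linked _⊏_ (inj₁ k ∷ us) → HasStep (total (inj₁ k)) us
      a-next s k []            n≤k budget _ = step-end {total (inj₁ k)} (spend s budget)
      a-next s k (inj₁ j ∷ us) n≤k budget ((k≤j , k≢j) ∷ chain) = a-chain (total (inj₁ k)) s j us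
        (n≤k (≤∧≢⇒< k≤j (λ eq → k≢j (cong inj₁ (Finₚ.toℕ-injective eq))))) budget chain
      a-next s k (inj₂ l ∷ us) n≤k budget ((k⊑l , _) ∷ chain) = step-here {total (inj₁ k)} {inj₂ l} {us} (switch k l k⊑l)

      a-chain a s k us n≤k budget chain with toℕ k <? k₀
      ... | yes k<k₀ = step-there {a} {inj₁ k} {us} (a-next s₀ k us
        (λ _ k₀≤j → ≤-trans n≤ (+-monoˡ-≤ s₀ k₀≤j))
        (≤-trans (+-monoˡ-≤ (suc s₀ * γ) (a-low k k<k₀)) a-budget) chain)
      ... | no k≮k₀ with a + γ ≤? total (inj₁ k)
      ... | yes le = step-here {a} {inj₁ k} {us} le
      a-chain a zero k us n≤k budget chain | no k≮k₀ | no nle =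
        contradiction (≤-trans (n≤k (≮⇒≥ k≮k₀)) (≤-reflexive (+-identityʳ _))) (<⇒≱ (Finₚ.toℕ<n k))
      a-chain a (suc s) k us n≤k budget chain | no k≮k₀ | no nle = step-there {a} {inj₁ k} {us} (a-next s k us
        (λ k<j _ → ≤-trans (n≤k (≮⇒≥ k≮k₀)) (≤-trans (≤-reflexive (+-suc (toℕ k) s)) (+-monoˡ-≤ s k<j)))
        (advance {a} {total (inj₁ k)} {top} {s} (≰⇒> nle) budget) chain)

      any-chain : ∀ u us → Linked _⊏_ (u ∷ us) → HasStep 0 (u ∷ us)
      any-chain (inj₁ k) us = a-chain 0 s₀ k us (λ k₀≤k → ≤-trans n≤ (+-monoˡ-≤ s₀ k₀≤k))
        (≤-trans (m≤n+m _ U) a-budget)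
      any-chain (inj₂ l) us = b-chain 0 r l us (m≤n+m r (toℕ l)) b-budget

      gap-≥ : φ 0 ≡ 0ℚ → φ top ≡ pos (suc (n + m)) ℚ./ 1 → (∀ x → φ (total (splitAt n x)) ≡ h P x) →
        (C : NonemptyChain P) → g ℚ.≤ gap P C
      gap-≥ φ-0 φ-top φ-h C = subst₂ (λ a c → g ℚ.≤ largestStep a (map (h P) ys) c) φ-0 φ-top
        (subst (λ hs → g ℚ.≤ largestStep (φ 0) hs (φ top)) heights
          (any-chain _ _ (Linkedₚ.map⁺ (Linked.map (λ {x} {y} (x≤y , x≢y) → x≤y , λ eq → x≢y (splitAt-injective x y eq))
            (NonemptyChain.increasing C)))))
        where
        ys : List (Fin (n + m))
        ys = toList (NonemptyChain.elements C)
        heights : map (φ ∘ total) (map (splitAt n) ys) ≡ map (h P) ys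
        heights = trans (sym (map-∘ ys)) (map-cong φ-h ys)

  total : Element → ℕ
  total u = totalHeight (join n m u)

  top : ℕ
  top = suc (n + m) * count

  module _ (g r B s₀ k₀ U : ℕ)
    (b-budget : suc r * (g * count) ≤ B)
    (b-high   : ∀ l → r ≤ toℕ l → B ≤ total (inj₂ l))
    (B≤top    : B ≤ top)
    (a-budget : U + suc s₀ * (g * count) ≤ top)
    (a-low    : ∀ k → toℕ k < k₀ → total (inj₁ k) ≤ U)
    (n≤       : n ≤ k₀ + s₀)
    (switch   : ∀ k l → inj₁ k ⊑ inj₂ l → total (inj₁ k) + g * count ≤ total (inj₂ l))
    where

    large-gap : (C : NonemptyChain P) → frac 1 g ℚ.≤ gap P C
    large-gap = ChainGap.gap-≥ total (g * count) top (frac count) (frac 1 g) (frac-step count g)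
      r B s₀ k₀ U b-budget b-high B≤top a-budget a-low n≤ switch
      (frac-0 count) (frac-scale count (suc (n + m)))
      (λ x → trans (cong (frac count ∘ totalHeight) (Finₚ.join-splitAt n m x)) (frac-totalHeight x))

    criterion : (i : Fin n) (l : Fin m) → toℕ l < ρ (toℕ i) →
      Σ[ P ∈ FinitePoset ] (HasWidth P 2 × ((C : NonemptyChain P) → frac 1 g ℚ.≤ gap P C))
    criterion i l l<ρ = P , width-two i l l<ρ , large-gap

-- The block poset and its parameters

module Construction (g q₀ p′ T′ : ℕ) .{{_ : NonZero g}}
  (q₀-large : 20 * (g * g) ≤ q₀) (p≡ : suc p′ ≡ suc q₀ * g) (T≡ : suc T′ ≡ suc (suc p′) * g) where

  p T : ℕ
  p = suc p′
  T = suc T′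

  S : ℕ → ℕ
  S zero    = 0
  S (suc i) = S i + (q₀ + i)

  n m : ℕ
  n = T * p
  m = S T

  ρ : ℕ → ℕ
  ρ k = S (suc (k / p))

  S-mono : ∀ {i j} → i ≤ j → S i ≤ S j
  S-mono {j = zero}  z≤n  = z≤n
  S-mono {i} {suc j} i≤1+j with m≤n⇒m<n∨m≡n i≤1+j
  ... | inj₁ (s≤s i≤j) = ≤-trans (S-mono i≤j) (m≤m+n (S j) _)
  ... | inj₂ refl      = ≤-refl

  ρ-mono : ∀ {i j} → i ≤ j → ρ i ≤ ρ j
  ρ-mono i≤j = S-mono (s≤s (/-monoˡ-≤ p i≤j))

  ρ≤m : ∀ {k} → k < n → ρ k ≤ m
  ρ≤m {k} k<n = S-mono (m<n*o⇒m/o<n {k} {T} {p} k<n)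

  block-/ : ∀ i {j} → j ≤ p′ → (i * p + j) / p ≡ i
  block-/ i {j} j≤p′ = begin
    (i * p + j) / p        ≡⟨ +-distrib-/-∣ˡ j (n∣m*n i {p}) ⟩
    i * p / p + j / p      ≡⟨ cong₂ _+_ (m*n/n≡m i p) (m<n⇒m/n≡0 (s≤s j≤p′)) ⟩
    i + 0                  ≡⟨ +-identityʳ i ⟩
    i                      ∎
    where
    open ≡-Reasoning

  ρ-block : ∀ i {j} → j ≤ p′ → ρ (i * p + j) ≡ S (suc i)
  ρ-block i j≤p′ = cong (S ∘ suc) (block-/ i j≤p′)

  open TwoChains n m ρ ρ-mono ρ≤m
  open Criterion n m ρ ρ-mono ρ≤m

  γ : ℕ
  γ = g * count

  open Paths ρ

  entry : ∀ i {y} → S i < y → reaching (i * p) y ≡ 0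
  entry zero    {suc y} _   = refl
  entry (suc i) {y}     S<y = reaching-> {p′ + i * p} (subst (_< y)
    (sym (trans (cong ρ (+-comm p′ (i * p))) (ρ-block i ≤-refl))) S<y)

  module _ (i : ℕ) (1+i<T : suc i < T) where

    last : ℕ
    last = i * p + p′

    1+last≡ : suc last ≡ suc i * p
    1+last≡ = trans (sym (+-suc (i * p) p′)) (+-comm (i * p) p)

    last<n : last < n
    last<n = ≤-trans (≤-reflexive 1+last≡) (*-monoˡ-≤ p (<⇒≤ 1+i<T))

    columns : ∃ λ e → n ≡ suc last + (p + e)
    columns with e , 2+i+e≡T ← m≤n⇒∃[o]m+o≡n 1+i<T = e * p , (begin
      T * p                        ≡⟨ cong (_* p) 2+i+e≡T ⟨
      (2 + i + e) * p              ≡⟨ split i e p ⟩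
      suc i * p + (p + e * p)      ≡⟨ cong (_+ (p + e * p)) 1+last≡ ⟨
      suc last + (p + e * p)       ∎)
      where
      open ≡-Reasoning
      split : ∀ i e p → (2 + i + e) * p ≡ suc i * p + (p + e * p)
      split = solve-∀

    deficit : sum (map (λ xs → lookup xs (fromℕ< last<n)) (paths n 0 0)) + γ ≤ S (suc i) * count
    deficit = subst (λ c → sum (map (λ xs → lookup xs (fromℕ< last<n)) (paths n 0 0)) + g * c ≤ S (suc i) * c)
      (sym count≡)
      (Corner.paths-deficit ρ-mono (i * p) p′ (S i) (q₀ + i) g (≤-trans q₀-large (m≤m+n q₀ i)) (entry i) (ρ-block i) next
        (proj₁ columns) (fromℕ< last<n) (Finₚ.toℕ-fromℕ< last<n) (proj₂ columns))
      where
      -- Consecutive rises differ by exactly one, the bend that `Corner` requires.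
      next : ∀ {j} → j ≤ p′ → ρ (suc last + j) ≡ S (suc i) + suc (q₀ + i)
      next {j} j≤p′ = trans (cong (λ t → ρ (t + j)) 1+last≡)
        (trans (ρ-block (suc i) j≤p′) (cong (S (suc i) +_) (+-suc q₀ i)))

  open ≤-Reasoning

  -- Pass from a_k to the last a of its block, a_κ, which has the same ρ. At least κ + 1 a's and l ≥
  -- ρ(κ) b's precede b_l, whereas on average only ρ(κ) - E[d] b's precede a_κ. So the heights
  -- differ by at least E[d] ≥ g.
  switch : ∀ k l → inj₁ k ⊑ inj₂ l → total (inj₁ k) + γ ≤ total (inj₂ l)
  switch k l ρ≤l = begin
    total (inj₁ k) + γ                                  ≤⟨ +-monoˡ-≤ γ (totalHeight-mono (inj₁ k) (inj₁ κ) k≤κ) ⟩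
    total (inj₁ κ) + γ                                  ≡⟨ cong (_+ γ) (totalHeight-a κ) ⟩
    count * suc (toℕ κ) + X + γ                         ≡⟨ +-assoc (count * suc (toℕ κ)) X γ ⟩
    count * suc (toℕ κ) + (X + γ)                       ≤⟨ +-monoʳ-≤ (count * suc (toℕ κ)) (deficit i 1+i<T) ⟩
    count * suc (toℕ κ) + S (suc i) * count             ≤⟨ +-monoʳ-≤ (count * suc (toℕ κ)) (*-monoˡ-≤ count ρ≤l) ⟩
    count * suc (toℕ κ) + toℕ l * count                 ≡⟨ collect count (toℕ κ) (toℕ l) ⟩
    count * (suc (toℕ κ) + toℕ l)                       ≤⟨ *-monoʳ-≤ count (n≤1+n (suc (toℕ κ) + toℕ l)) ⟩
    count * suc (suc (toℕ κ) + toℕ l)                   ≤⟨ totalHeight-b-lower l (Finₚ.toℕ<n κ) (λ j≤κ → ≤-trans (ρ-mono (s≤s⁻¹ j≤κ)) ρκ≤l) ⟩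
    total (inj₂ l)                                      ∎
    where
    i = toℕ k / p
    1+i<T : suc i < T
    -- In the last block ρ equals `m`, so no b lies above its a's; hence a further block exists and
    -- the corner estimate applies.
    1+i<T = ≰⇒> (λ T≤1+i → <⇒≱ (Finₚ.toℕ<n l) (≤-trans (S-mono T≤1+i) ρ≤l))
    κ : Fin n
    κ = fromℕ< (last<n i 1+i<T)
    X = sum (map (λ xs → lookup xs κ) (paths n 0 0))
    toℕ-κ : toℕ κ ≡ i * p + p′
    toℕ-κ = Finₚ.toℕ-fromℕ< (last<n i 1+i<T)
    k≤κ : toℕ k ≤ toℕ κ
    k≤κ = begin
      toℕ k                   ≡⟨ m≡m%n+[m/n]*n (toℕ k) p ⟩
      toℕ k % p + i * p       ≤⟨ +-monoˡ-≤ (i * p) (s≤s⁻¹ (m%n<n (toℕ k) p)) ⟩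
      p′ + i * p              ≡⟨ +-comm p′ (i * p) ⟩
      i * p + p′              ≡⟨ toℕ-κ ⟨
      toℕ κ                   ∎
    ρκ≤l : ρ (toℕ κ) ≤ toℕ l
    ρκ≤l = ≤-trans (≤-reflexive (trans (cong ρ toℕ-κ) (ρ-block i ≤-refl))) ρ≤l
    collect : ∀ c k l → c * suc k + l * c ≡ c * (suc k + l)
    collect = solve-∀

  b-budget : suc q₀ * γ ≤ p * count
  b-budget = ≤-reflexive (trans (sym (*-assoc (suc q₀) g count)) (cong (_* count) (sym p≡)))

  p≤n : p ≤ n
  p≤n = m≤m+n p (T′ * p)

  S1≡q₀ : S 1 ≡ q₀
  S1≡q₀ = +-identityʳ q₀

  b-high : ∀ l → q₀ ≤ toℕ l → p * count ≤ total (inj₂ l)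
  b-high l q₀≤l = begin
    p * count                     ≡⟨ *-comm p count ⟩
    count * p                     ≤⟨ *-monoʳ-≤ count (m≤n⇒m≤1+n (m≤m+n p (toℕ l))) ⟩
    count * suc (p + toℕ l)       ≤⟨ totalHeight-b-lower l p≤n (λ i<p → ≤-trans (≤-reflexive (trans (ρ-block 0 (s≤s⁻¹ i<p)) S1≡q₀)) q₀≤l) ⟩
    total (inj₂ l)                ∎

  p≤top : p * count ≤ top
  p≤top = *-monoˡ-≤ count (≤-trans p≤n (m≤n⇒m≤1+n (m≤m+n n m)))

  a-budget : (T′ * p + S T′) * count + suc p * γ ≤ top
  a-budget = begin
    (T′ * p + S T′) * count + suc p * γ            ≡⟨ factor (T′ * p + S T′) count (suc p) g ⟩
    (T′ * p + S T′ + suc p * g) * count            ≤⟨ *-monoˡ-≤ count fits ⟩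
    suc (n + m) * count                            ∎
    where
    factor : ∀ u c p g → u * c + p * (g * c) ≡ (u + p * g) * c
    factor = solve-∀
    slack : ∀ x s p q t → x + s + suc t + (p + q) ≡ suc (p + x + (s + (q + t)))
    slack = solve-∀
    -- The last block contributes p a's and q₀ + T′ b's. With the final + 1 this is `T` = (p + 1)g
    -- and a surplus of p + q₀.
    fits : T′ * p + S T′ + suc p * g ≤ suc (n + m)
    fits = subst (λ t → T′ * p + S T′ + t ≤ suc (n + m)) T≡ (≤-trans (m≤m+n _ (p + q₀)) (≤-reflexive (slack (T′ * p) (S T′) p q₀ T′)))

  a-low : ∀ k → toℕ k < T′ * p → total (inj₁ k) ≤ (T′ * p + S T′) * count
  a-low k k<k₀ = begin
    total (inj₁ k)                            ≤⟨ totalHeight-a-upper k ⟩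
    count * suc (toℕ k + ρ (toℕ k))           ≤⟨ *-monoʳ-≤ count (+-mono-≤ k<k₀ (S-mono (m<n*o⇒m/o<n {toℕ k} {T′} {p} k<k₀))) ⟩
    count * (T′ * p + S T′)                   ≡⟨ *-comm count (T′ * p + S T′) ⟩
    (T′ * p + S T′) * count                   ∎

  blockPoset : Σ[ P ∈ FinitePoset ] (HasWidth P 2 × ((C : NonemptyChain P) → frac 1 g ℚ.≤ gap P C))
  blockPoset = criterion g q₀ (p * count) p (T′ * p) ((T′ * p + S T′) * count)
    b-budget b-high p≤top a-budget a-low (≤-reflexive (+-comm p (T′ * p))) switch
    -- a_0 and b_0 form the antichain of size two, since ρ(0) = q₀ > 0.
    fzero (fromℕ< 0<m) (subst (_< ρ 0) (sym (Finₚ.toℕ-fromℕ< 0<m)) 0<ρ0)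
    where
    0<ρ0 : 0 < S 1
    0<ρ0 = subst (0 <_) (sym S1≡q₀) (≤-trans (m≤m*n 1 (20 * (g * g)) {{m*n≢0 20 (g * g) {{_}} {{m*n≢0 g g}}}}) (≤-trans (≤-reflexive (*-identityˡ _)) q₀-large))
    0<m : 0 < m
    0<m = ≤-trans 0<ρ0 (S-mono {1} {T} (s≤s z≤n))

abstract

  wide-gap-poset : ∀ g .{{_ : NonZero g}} →
    Σ[ P ∈ FinitePoset ] (HasWidth P 2 × ((C : NonemptyChain P) → frac 1 g ℚ.≤ gap P C))
  -- With g = suc g′, the values of `p′` and `T′` make both required equations hold by computation.
  wide-gap-poset g@(suc g′) = Construction.blockPoset g q₀ p′ (g′ + suc p′ * g) ≤-refl refl refl
    where
    q₀ p′ : ℕ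
    q₀ = 20 * (g * g)
    p′ = g′ + q₀ * g

-- From natural to real lower bounds

ℚ-archimedean : ∀ q → ∃ λ g′ → q ℚ.≤ pos (suc g′) ℚ./ 1
ℚ-archimedean q@(mkℚ i d _) = ℤ.∣ i ∣ , ℚₚ.toℚᵘ-cancel-≤ (ℚᵘₚ.≤-respʳ-≃
  (ℚᵘₚ.≃-sym (toℚᵘ-/ (pos (suc ℤ.∣ i ∣)) 1)) (*≤* (subst₂ ℤ._≤_ (sym (ℤₚ.*-identityʳ i)) (ℤₚ.pos-* (suc ℤ.∣ i ∣) (suc d)) (bound i))))
  where
  bound : ∀ i → i ℤ.≤ pos (suc ℤ.∣ i ∣ * suc d)
  bound (pos a)    = ℤ.+≤+ (≤-trans (n≤1+n a) (m≤m*n (suc a) (suc d)))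
  bound -[1+ a ] = ℤ.-≤+

-- Regularity allows a difference of at most 1/(n+1) + 1 ≤ 2 from the term of index 0, so a single
-- rational bounds every approximation of the real number.
regular-bound : ∀ (x : ℝ) n → seq x n ℚ.≤ seq x 0 ℚ.+ (pos 2 ℚ./ 1)
regular-bound x n = begin
  seq x n                                              ≡⟨ ℚₚ.+-identityʳ (seq x n) ⟨
  seq x n ℚ.+ 0ℚ                                       ≡⟨ cong (seq x n ℚ.+_) (ℚₚ.+-inverseˡ (seq x 0)) ⟨
  seq x n ℚ.+ (ℚ.- seq x 0 ℚ.+ seq x 0)                ≡⟨ ℚₚ.+-assoc (seq x n) (ℚ.- seq x 0) (seq x 0) ⟨
  seq x n ℚ.- seq x 0 ℚ.+ seq x 0                      ≤⟨ ℚₚ.+-monoˡ-≤ (seq x 0) difference ⟩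
  (pos 2 ℚ./ 1) ℚ.+ seq x 0                              ≡⟨ ℚₚ.+-comm (pos 2 ℚ./ 1) (seq x 0) ⟩
  seq x 0 ℚ.+ (pos 2 ℚ./ 1)                              ∎
  where
  open ℚₚ.≤-Reasoning
  1/≤1 : pos 1 ℚ./ suc n ℚ.≤ pos 1 ℚ./ 1
  1/≤1 = ℚₚ.toℚᵘ-cancel-≤ (ℚᵘₚ.≤-respˡ-≃ (ℚᵘₚ.≃-sym (toℚᵘ-/ (pos 1) (suc n)))
    (ℚᵘₚ.≤-respʳ-≃ (ℚᵘₚ.≃-sym (toℚᵘ-/ (pos 1) 1)) (*≤* (ℤ.+≤+ (s≤s z≤n)))))
  p≤∣p∣ : ∀ p → p ℚ.≤ ℚ.∣ p ∣
  p≤∣p∣ p with ℚₚ.≤-total 0ℚ p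
  ... | inj₁ 0≤p = ℚₚ.≤-reflexive (sym (ℚₚ.0≤p⇒∣p∣≡p 0≤p))
  ... | inj₂ p≤0 = ℚₚ.≤-trans p≤0 (ℚₚ.0≤∣p∣ p)
  difference : seq x n ℚ.- seq x 0 ℚ.≤ pos 2 ℚ./ 1
  difference = begin
    seq x n ℚ.- seq x 0                      ≤⟨ p≤∣p∣ (seq x n ℚ.- seq x 0) ⟩
    ℚ.∣ seq x n ℚ.- seq x 0 ∣                ≤⟨ ℝ.regular x n 0 ⟩
    (pos 1 ℚ./ suc n) ℚ.+ (pos 1 ℚ./ 1)          ≤⟨ ℚₚ.+-monoˡ-≤ (pos 1 ℚ./ 1) 1/≤1 ⟩
    (pos 1 ℚ./ 1) ℚ.+ (pos 1 ℚ./ 1)              ≡⟨⟩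
    pos 2 ℚ./ 1                                ∎

≥ℝ-from-natural : ∀ (L : ℝ) g q → seq L 0 ℚ.+ (pos 2 ℚ./ 1) ℚ.≤ pos g ℚ./ 1 → frac 1 g ℚ.≤ q → fromℚ q ≥ℝ L
≥ℝ-from-natural L g q L≤g g≤q k = begin
  seq L k                      ≤⟨ regular-bound L k ⟩
  seq L 0 ℚ.+ (pos 2 ℚ./ 1)    ≤⟨ L≤g ⟩
  pos g ℚ./ 1                  ≡⟨ frac-1 g ⟨
  frac 1 g                     ≤⟨ g≤q ⟩
  q                            ≡⟨ ℚₚ.+-identityʳ q ⟨
  q ℚ.+ 0ℚ                     ≤⟨ ℚₚ.+-monoʳ-≤ q (ℚₚ.nonNegative⁻¹ (pos 2 ℚ./ suc k) {{ℚₚ.normalize-nonNeg 2 (suc k)}}) ⟩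
  q ℚ.+ (pos 2 ℚ./ suc k)      ∎
  where open ℚₚ.≤-Reasoning

theorem5p1 : (L : ℝ) → 0ℝ <ℝ L →
    Σ[ P ∈ FinitePoset ] (HasWidth P 2 × ((C : NonemptyChain P) → fromℚ (gap P C) ≥ℝ L))
theorem5p1 L _ =
  let g′ , L≤g              = ℚ-archimedean (seq L 0 ℚ.+ (pos 2 ℚ./ 1))
      P , width , large-gap = wide-gap-poset (suc g′)
  in  P , width , λ C → ≥ℝ-from-natural L (suc g′) (gap P C) L≤g (large-gap C)
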